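{- Let $L$ be a Linnik constant. Then there is a constant $C>0$ (depending only on $L$) such that: (i) for every positive integer $n$ there exists a positive integer $m\le C n^{2L+1}$ with $d(m)=f(m)=n$; (ii) for every positive integer $n$ there exists a positive integer $m\le C n^{6L+3}$ with $d(m)/f(m)=n$; (iii) for all positive integers $a,b$ with $a\mid b$ and $\gcd\big(b/a,\ a\,\varphi(\mathrm{rad}(b))\big)=1$, there exists a positive integer $m\le C b^{2L+2}/a$ with $f(m)=a$ and $d(m)=b$.
   Context: For a positive integer $m$, let $\varphi(m)$ be Euler's function and $\lambda(m)$ the Carmichael function (the exponent of the multiplicative group $(\mathbb{Z}/m\mathbb{Z})^*$). Let $\mathrm{rad}(m)$ be the product of the distinct primes dividing $m$. Let $\delta=2$ if $4\mid m$ and $\delta=1$ otherwise. Define $$ d(m)=\gcd\big(m,\ \delta\,\varphi(\mathrm{rad}(m))\big),\qquad f(m)=\gcd\big(m,\ \delta\,\lambda(m)\varphi(\mathrm{rad}(m))/\varphi(m)\big). $$ A Linnik constant is a positive number $L$ such that there is an absolute constant $c>0$ with the property that for all integers $1\le a<q$ with $\gcd(a,q)=1$, the smallest prime $p(a,q)$ in the progression $\{a+jq: j\ge 0\}$ satisfies $p(a,q)\le c\, q^L$ (such $L$ exist by Linnik's theorem; e.g. $L=5$ works). -}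

module Defs where

open import Data.Bool.Base using (if_then_else_)
open import Data.Integer.Base using (+_)
open import Data.List.Base using (List; length; filter; upTo; applyUpTo; head)
open import Data.List.Membership.Propositional using (_∈_)
open import Data.List.Membership.Propositional.Properties using (∈-filter⁺; ∈-upTo⁺)
open import Data.List.Relation.Unary.All using (All; all?)
open import Data.List.Relation.Unary.Any using (here; there)
open import Data.Maybe.Base using (fromMaybe)
open import Data.Nat.Base as ℕ using (ℕ; zero; suc; NonZero; z≤n; s≤s; ∣_-_∣)
open import Data.Nat.Coprimality using (coprime?; 1-coprimeTo)
open import Data.Nat.DivMod using (_/_)
open import Data.Nat.Divisibility using (_∣_; _∣?_)
open import Data.Nat.GCD using (gcd)
open import Data.Nat.ListAction using (product)
open import Data.Nat.Primality using (Prime; prime?)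
open import Data.Product.Base using (∃-syntax; _×_; _,_)
open import Data.Rational.Base as ℚ using (ℚ; 0ℚ; ½; _<_; _≤_; _+_; _-_; _*_)
import Data.Rational.Properties as ℚₚ
open import Relation.Binary.PropositionalEquality using (_≡_; sym; trans; cong; subst)
open import Relation.Nullary.Decidable using (Dec; does; _×-dec_)

-- Arithmetic functions

units : ℕ → List ℕ
units m = filter (λ k → coprime? k m) (upTo m)

φ : ℕ → ℕ
φ m = length (units m)

rad : ℕ → ℕ
rad m = product (filter (λ p → prime? p ×-dec p ∣? m) (upTo (suc m)))

Annihilates : ℕ → ℕ → Set
Annihilates m e = All (λ k → m ∣ ∣ k ℕ.^ e - 1 ∣) (units m)

annihilates? : ∀ m e → Dec (Annihilates m e)
annihilates? m e = all? (λ k → m ∣? ∣ k ℕ.^ e - 1 ∣) (units m)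

-- The exponent of (ℤ/m)*, i.e. the least e ≥ 1 with kᵉ ≡ 1 (mod m) for every
-- unit k.  By Euler's theorem φ m is such an e when m ≥ 1, so the search below
-- φ m always succeeds and the default is never used.
carmichael : ℕ → ℕ
carmichael m = fromMaybe (φ m) (head (filter (annihilates? m) (applyUpTo suc (φ m))))

δ : ℕ → ℕ
δ m = if does (4 ∣? m) then 2 else 1

d : ℕ → ℕ
d m = gcd m (δ m ℕ.* φ (rad m))

φ-nonZero : ∀ m .{{_ : NonZero m}} → NonZero (φ m)
φ-nonZero 1             = _
φ-nonZero (suc (suc n)) = nonEmpty (∈-filter⁺ (λ k → coprime? k (suc (suc n)))
  (∈-upTo⁺ {suc (suc n)} {1} (s≤s (s≤s z≤n))) (1-coprimeTo _))
  where
  nonEmpty : ∀ {x} {xs : List ℕ} → x ∈ xs → NonZero (length xs)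
  nonEmpty (here _)  = _
  nonEmpty (there _) = _

-- The quotient is exact: δ(m)·λ(m)·φ(rad m)/φ(m) = δ(m)·λ(m)·rad(m)/m and
-- m/rad(m) divides δ(m)·λ(m).
f : (m : ℕ) .{{_ : NonZero m}} → ℕ
f m = gcd m ((δ m ℕ.* carmichael m ℕ.* φ (rad m)) / φ m)
  where instance
    _ = φ-nonZero m

-- Real numbers as (two-sided, located) Dedekind cuts: Lower q means q < x and
-- Upper r means x < r.

record ℝ : Set₁ where
  field
    Lower Upper  : ℚ → Set
    lower-closed : ∀ {p q} → p < q → Lower q → Lower p
    upper-closed : ∀ {q r} → q < r → Upper q → Upper r
    lower-open   : ∀ {q} → Lower q → ∃[ q′ ] q < q′ × Lower q′
    upper-open   : ∀ {r} → Upper r → ∃[ r′ ] r′ < r × Upper r′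
    separated    : ∀ {q r} → Lower q → Upper r → q < r
    located      : ∀ ε → 0ℚ < ε → ∃[ q ] ∃[ r ] Lower q × Upper r × r ≤ q + ε

open ℝ public

private
  half+half : ∀ p → ½ * p + ½ * p ≡ p
  half+half p = trans (sym (ℚₚ.*-distribʳ-+ p ½ ½)) (ℚₚ.*-identityˡ p)

  half>0 : ∀ {p} → 0ℚ < p → 0ℚ < ½ * p
  half>0 {p} p>0 = subst (_< ½ * p) (ℚₚ.*-zeroʳ ½) (ℚₚ.*-monoʳ-<-pos ½ p>0)

  interchange : ∀ a b c e → (a + b) + (c + e) ≡ (a + c) + (b + e)
  interchange a b c e =
    trans (ℚₚ.+-assoc a b (c + e))
    (trans (cong (λ t → a + t)
      (trans (sym (ℚₚ.+-assoc b c e))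
      (trans (cong (_+ e) (ℚₚ.+-comm b c)) (ℚₚ.+-assoc c b e))))
    (sym (ℚₚ.+-assoc a c (b + e))))

  p<p+ε : ∀ p {ε} → 0ℚ < ε → p < p + ε
  p<p+ε p {ε} ε>0 = subst (_< p + ε) (ℚₚ.+-identityʳ p) (ℚₚ.+-monoʳ-< p ε>0)

  p-ε+ε : ∀ p ε → (p - ε) + ε ≡ p
  p-ε+ε p ε = trans (ℚₚ.+-assoc p (ℚ.- ε) ε)
    (trans (cong (λ t → p + t) (ℚₚ.+-inverseˡ ε)) (ℚₚ.+-identityʳ p))

  p-ε<p : ∀ p {ε} → 0ℚ < ε → p - ε < p
  p-ε<p p {ε} ε>0 = subst (p - ε <_) (p-ε+ε p ε) (p<p+ε (p - ε) ε>0)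

fromℚ : ℚ → ℝ
fromℚ x .Lower q = q < x
fromℚ x .Upper r = x < r
fromℚ x .lower-closed p<q q<x = ℚₚ.<-trans p<q q<x
fromℚ x .upper-closed q<r x<q = ℚₚ.<-trans x<q q<r
fromℚ x .lower-open q<x = ℚₚ.<-dense q<x
fromℚ x .upper-open x<r with r′ , x<r′ , r′<r ← ℚₚ.<-dense x<r = r′ , r′<r , x<r′
fromℚ x .separated q<x x<r = ℚₚ.<-trans q<x x<r
fromℚ x .located ε ε>0 = x - η , x + η , p-ε<p x η>0 , p<p+ε x η>0 , ℚₚ.≤-reflexive eq
  where
  η = ½ * ε
  η>0 = half>0 ε>0
  eq : x + η ≡ (x - η) + ε
  eq = trans (cong (_+ η) (sym (p-ε+ε x η)))
    (trans (ℚₚ.+-assoc (x - η) η η) (cong (λ t → (x - η) + t) (half+half ε)))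

fromℕ : ℕ → ℝ
fromℕ n = fromℚ (+ n ℚ./ 1)

infixl 6 _⊕_
_⊕_ : ℝ → ℝ → ℝ
(x ⊕ y) .Lower q = ∃[ a ] ∃[ b ] Lower x a × Lower y b × q < a + b
(x ⊕ y) .Upper r = ∃[ a ] ∃[ b ] Upper x a × Upper y b × a + b < r
(x ⊕ y) .lower-closed p<q (a , b , la , lb , q<) = a , b , la , lb , ℚₚ.<-trans p<q q<
(x ⊕ y) .upper-closed q<r (a , b , ua , ub , <q) = a , b , ua , ub , ℚₚ.<-trans <q q<r
(x ⊕ y) .lower-open (a , b , la , lb , q<) with q′ , q<q′ , q′< ← ℚₚ.<-dense q< =
  q′ , q<q′ , a , b , la , lb , q′<
(x ⊕ y) .upper-open (a , b , ua , ub , <r) with r′ , <r′ , r′<r ← ℚₚ.<-dense <r =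
  r′ , r′<r , a , b , ua , ub , <r′
(x ⊕ y) .separated (a , b , la , lb , q<) (a′ , b′ , ua , ub , <r) =
  ℚₚ.<-trans q< (ℚₚ.<-trans (ℚₚ.+-mono-< (separated x la ua) (separated y lb ub)) <r)
(x ⊕ y) .located ε ε>0
  with a , a′ , la , ua , a′≤ ← located x (½ * ε) (half>0 ε>0)
     | b , b′ , lb , ub , b′≤ ← located y (½ * ε) (half>0 ε>0)
  with a₁ , a<a₁ , la₁ ← lower-open x la
     | a₂ , a₂<a′ , ua₂ ← upper-open x ua =
  a + b , a′ + b′ ,
  (a₁ , b , la₁ , lb , ℚₚ.+-monoˡ-< b a<a₁) ,
  (a₂ , b′ , ua₂ , ub , ℚₚ.+-monoˡ-< b′ a₂<a′) ,
  subst (a′ + b′ ≤_)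
    (trans (interchange a (½ * ε) b (½ * ε)) (cong (λ t → (a + b) + t) (half+half ε)))
    (ℚₚ.+-mono-≤ a′≤ b′≤)

infixl 7 _·_
_·_ : ℕ → ℝ → ℝ
zero  · x = fromℕ 0
suc k · x = x ⊕ k · x

Positive : ℝ → Set
Positive x = Lower x 0ℚ

-- The inequality m ≤ c·nˣ, for real c > 0 and x ≥ 0 and an integer n ≥ 1.  For
-- such arguments c·nˣ is the infimum of (u/v)·n^(p/s) over the rationals
-- u/v > c and p/s > x, and m ≤ (u/v)·n^(p/s) reads (v·m)ˢ ≤ uˢ·nᵖ once
-- denominators and the root are cleared.
infix 4 _≤ᴿ_∙_↑_
_≤ᴿ_∙_↑_ : ℕ → ℝ → ℕ → ℝ → Set
m ≤ᴿ c ∙ n ↑ x =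
  ∀ (u v p s : ℕ) .{{_ : NonZero v}} .{{_ : NonZero s}} →
  Upper c (+ u ℚ./ v) → Upper x (+ p ℚ./ s) →
  (v ℕ.* m) ℕ.^ s ℕ.≤ u ℕ.^ s ℕ.* n ℕ.^ p

-- Linnik constants

record IsLeastPrimeInProgression (a q p : ℕ) : Set where
  field
    prime         : Prime p
    inProgression : ∃[ j ] p ≡ a ℕ.+ j ℕ.* q
    least         : ∀ j → Prime (a ℕ.+ j ℕ.* q) → p ℕ.≤ a ℕ.+ j ℕ.* q

LinnikConstant : ℝ → Set₁
LinnikConstant L =
  Positive L ×
  (∃[ c ] Positive c ×
    (∀ a q → 1 ℕ.≤ a → a ℕ.< q → gcd a q ≡ 1 →
      ∃[ p ] IsLeastPrimeInProgression a q p × p ≤ᴿ c ∙ q ↑ L))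

{-# OPTIONS --safe #-}

-- Apart from m = 1 and m = 8, every m is N·p with p a large prime from Linnik's theorem.
-- Put R = rad N and Q = N/R, so that φ(N) = Q φ(R).  Lagrange's bound on the
-- number of roots of xᵉ − 1 modulo p makes λ(m) a multiple of p − 1, and Euler's
-- theorem bounds λ(m) from above, so λ(m) = (p − 1)h with h dividing a controlled
-- factor K.  As p divides neither δ(N)φ(R) nor K, this gives
--   d(m) = gcd(N, δ(N)(p − 1)φ(R)),   f(m) = gcd(N, δ(N)(p − 1)h/Q),
-- and it remains to choose N and the residue of p modulo a power of its primes:
-- the exact N-part of p − 1 is prescribed by a congruence p ≡ 1 + s (mod s n).

module Submission where

open import Data.Bool.Base using (true; false; if_then_else_)
open import Data.Empty using (⊥)
import Data.Integer.Base as ℤ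
import Data.Integer.Properties as ℤₚ
open import Data.List.Base using ([]; _∷_; _++_; length; filter; head; applyUpTo; upTo)
open import Data.List.Membership.Propositional using (_∈_)
open import Data.List.Membership.Propositional.Properties using (∈-filter⁺; ∈-filter⁻; ∈-upTo⁺)
open import Data.List.Properties using (upTo-∷ʳ; filter-++; length-++; length-filter; length-upTo)
open import Data.List.Relation.Unary.All as All using (All; []; _∷_)
open import Data.Maybe.Base using (fromMaybe)
open import Data.Nat
open import Data.Nat.Combinatorics using (nC1≡n; nCn≡1; k>n⇒nCk≡0; nCk+nC[k+1]≡[n+1]C[k+1])
  renaming (_C_ to _𝐂_)
open import Data.Nat.Coprimality as Cop using (Coprime; coprime?; coprime-divisor; prime⇒coprime)
open import Data.Nat.Divisibility
open import Data.Nat.DivMod using (m*n/n≡m; m≡m%n+[m/n]*n; m%n<n)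
open import Data.Nat.GCD using (gcd; gcd-greatest; gcd[m,n]∣m; gcd[m,n]∣n; c*gcd[m,n]≡gcd[cm,cn])
open import Data.Nat.ListAction using (product)
open import Data.Nat.ListAction.Properties using (product-++)
open import Data.Nat.Primality
open import Data.Nat.Primality.Factorisation using (factorise; module PrimeFactorisation)
open import Data.Nat.Properties
open import Data.Nat.Tactic.RingSolver using (solve-∀)
open import Data.Product using (Σ-syntax; ∃-syntax; _×_; _,_; proj₁; proj₂)
open import Data.Rational.Base as ℚ using (mkℚ; 0ℚ; 1ℚ; toℚᵘ)
import Data.Rational.Properties as ℚₚ
open import Data.Rational.Unnormalised.Base as ℚᵘ using (mkℚᵘ; *<*)
import Data.Rational.Unnormalised.Properties as ℚᵘₚ
open import Data.Sum using (_⊎_; inj₁; inj₂; [_,_]′)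
open import Function.Base using (_∘_; id; _$_)
open import Relation.Binary.PropositionalEquality
open import Relation.Nullary using (Dec; yes; no; does; ¬_; contradiction; _×-dec_)
open import Relation.Nullary.Decidable using (dec-true; dec-false)
open import Relation.Unary using (Decidable)
open import Defs

-- The cofactor `h` in λ(m) = (p - 1)h is never computed; the choices of N and p make its value
-- irrelevant. In (i) the second argument of each gcd is a multiple of `n`, whatever `h` is. In (ii)
-- and (iii) the wanted value divides f for the same reason, but it must also bound f from above, so
-- `h` has to avoid the primes of `n`, respectively of b/a. Hence p - 1 is made to contain the
-- harmful part of φ(N), which leaves a factor K prime to them. The exact part of p - 1 is
-- prescribed for the same purpose: a congruence p ≡ 1 alone bounds the gcds only from below. The
-- prime 2 is the obstacle in (iii), since δ can enter both gcds. When b/a is even, coprimality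
-- leaves only a = 1 and b a power of 2, and there Euler's exponent is too large by a factor 2. The
-- exponents in the theorem record sizes. The moduli given to Linnik's theorem are at most n², n⁶
-- and b², and the cofactors N at most n, n³ and b²/a.

private variable
  a a′ b b′ c k l m n p q r x y : ℕ

-- Finite sums and products over initial segments

Σ< : (ℕ → ℕ) → ℕ → ℕ
Σ< g zero    = 0
Σ< g (suc n) = Σ< g n + g n

Π< : (ℕ → ℕ) → ℕ → ℕ
Π< g zero    = 1
Π< g (suc n) = Π< g n * g n

-- Has the shape of the conditional in `δ`, so that `δ m` is `choose (4 ∣? m) 2 1` by definition and
-- the lemmas on indicator functions serve for `δ` too.
choose : ∀ {a} {A : Set a} → Dec A → ℕ → ℕ → ℕ
choose A? x y = if does A? then x else y

choose-yes : ∀ {a} {A : Set a} (A? : Dec A) {x y} → A → choose A? x y ≡ x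
choose-yes A? {x} {y} a = cong (λ b → if b then x else y) (dec-true A? a)

choose-no : ∀ {a} {A : Set a} (A? : Dec A) {x y} → ¬ A → choose A? x y ≡ y
choose-no A? {x} {y} ¬a = cong (λ b → if b then x else y) (dec-false A? ¬a)

choose-cong : ∀ {a b} {A : Set a} {B : Set b} (A? : Dec A) (B? : Dec B) {x y} →
  (A → B) → (B → A) → choose A? x y ≡ choose B? x y
choose-cong (yes a) B? f g = sym (choose-yes B? (f a))
choose-cong (no ¬a) B? f g = sym (choose-no B? (¬a ∘ g))

Σ<-cong : ∀ {g h} n → (∀ k → g k ≡ h k) → Σ< g n ≡ Σ< h n
Σ<-cong zero    eq = refl
Σ<-cong (suc n) eq = cong₂ _+_ (Σ<-cong n eq) (eq n)

Σ<-+ : ∀ g a b → Σ< g (a + b) ≡ Σ< g a + Σ< (λ k → g (a + k)) b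
Σ<-+ g a zero = trans (cong (Σ< g) (+-identityʳ a)) (sym (+-identityʳ _))
Σ<-+ g a (suc b) rewrite +-suc a b | Σ<-+ g a b = +-assoc (Σ< g a) _ _

Σ<-distrib-+ : ∀ g h n → Σ< (λ k → g k + h k) n ≡ Σ< g n + Σ< h n
Σ<-distrib-+ g h zero = refl
Σ<-distrib-+ g h (suc n) rewrite Σ<-distrib-+ g h n = eq (Σ< g n) (Σ< h n) (g n) (h n)
  where
  eq : ∀ a b c e → (a + b) + (c + e) ≡ (a + c) + (b + e)
  eq = solve-∀

Σ<-periodic : ∀ g m → (∀ k → g (m + k) ≡ g k) → ∀ n → Σ< g (n * m) ≡ n * Σ< g m
Σ<-periodic g m per zero    = refl
Σ<-periodic g m per (suc n) = trans (Σ<-+ g m (n * m))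
  (cong (Σ< g m +_) (trans (Σ<-cong (n * m) per) (Σ<-periodic g m per n)))

Σ<-head : ∀ g n → (∀ k → k < n → g (suc k) ≡ 0) → Σ< g (suc n) ≡ g 0
Σ<-head g zero    z = refl
Σ<-head g (suc n) z rewrite Σ<-head g n (λ k k<n → z k (m<n⇒m<1+n k<n)) | z n ≤-refl = +-identityʳ _

-- The range falls into `n` blocks of length `suc r`, and in each block only the first element is a
-- multiple.
Σ<-multiples : ∀ (g : ℕ → ℕ) n r → Σ< (λ k → choose (suc r ∣? k) (g k) 0) (n * suc r) ≡ Σ< (λ k → g (k * suc r)) n
Σ<-multiples g zero    r = refl
Σ<-multiples g (suc n) r = begin
  Σ< h (ρ + n * ρ)                          ≡⟨ cong (Σ< h) (+-comm ρ (n * ρ)) ⟩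
  Σ< h (n * ρ + ρ)                          ≡⟨ Σ<-+ h (n * ρ) ρ ⟩
  Σ< h (n * ρ) + Σ< (λ k → h (n * ρ + k)) ρ ≡⟨ cong₂ _+_ (Σ<-multiples g n r) block ⟩
  Σ< (λ k → g (k * ρ)) n + g (n * ρ)        ∎
  where
  open ≡-Reasoning
  ρ = suc r
  h = λ k → choose (ρ ∣? k) (g k) 0
  block : Σ< (λ k → h (n * ρ + k)) ρ ≡ g (n * ρ)
  block = trans
    (Σ<-head (λ k → h (n * ρ + k)) r (λ k k<r → choose-no (ρ ∣? (n * ρ + suc k))
      (λ p∣ → >⇒∤ (s<s k<r) (∣m+n∣m⇒∣n p∣ (n∣m*n n)))))
    (trans (cong h (+-identityʳ (n * ρ))) (choose-yes (ρ ∣? (n * ρ)) (n∣m*n n)))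

length-filter-upTo : ∀ {P : ℕ → Set} (P? : Decidable P) n →
  length (filter P? (upTo n)) ≡ Σ< (λ k → choose (P? k) 1 0) n
length-filter-upTo P? zero = refl
length-filter-upTo P? (suc n) = begin
  length (filter P? (upTo (suc n)))                         ≡⟨ cong (length ∘ filter P?) (upTo-∷ʳ n) ⟨
  length (filter P? (upTo n ++ n ∷ []))                     ≡⟨ cong length (filter-++ P? (upTo n) (n ∷ [])) ⟩
  length (filter P? (upTo n) ++ filter P? (n ∷ []))         ≡⟨ length-++ (filter P? (upTo n)) ⟩
  length (filter P? (upTo n)) + length (filter P? (n ∷ [])) ≡⟨ cong₂ _+_ (length-filter-upTo P? n) last ⟩
  Σ< (λ k → choose (P? k) 1 0) (suc n)                      ∎
  where
  open ≡-Reasoning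
  last : length (filter P? (n ∷ [])) ≡ choose (P? n) 1 0
  last with does (P? n)
  ... | true  = refl
  ... | false = refl

product-filter-upTo : ∀ {P : ℕ → Set} (P? : Decidable P) n →
  product (filter P? (upTo n)) ≡ Π< (λ k → choose (P? k) k 1) n
product-filter-upTo P? zero = refl
product-filter-upTo P? (suc n) = begin
  product (filter P? (upTo (suc n)))                          ≡⟨ cong (product ∘ filter P?) (upTo-∷ʳ n) ⟨
  product (filter P? (upTo n ++ n ∷ []))                      ≡⟨ cong product (filter-++ P? (upTo n) (n ∷ [])) ⟩
  product (filter P? (upTo n) ++ filter P? (n ∷ []))          ≡⟨ product-++ (filter P? (upTo n)) _ ⟩
  product (filter P? (upTo n)) * product (filter P? (n ∷ [])) ≡⟨ cong₂ _*_ (product-filter-upTo P? n) last ⟩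
  Π< (λ k → choose (P? k) k 1) (suc n)                        ∎
  where
  open ≡-Reasoning
  last : product (filter P? (n ∷ [])) ≡ choose (P? n) n 1
  last with does (P? n)
  ... | true  = *-identityʳ n
  ... | false = refl

Π<-cong : ∀ {g h} n → (∀ k → g k ≡ h k) → Π< g n ≡ Π< h n
Π<-cong zero    eq = refl
Π<-cong (suc n) eq = cong₂ _*_ (Π<-cong n eq) (eq n)

Π<-distrib-* : ∀ g h n → Π< (λ k → g k * h k) n ≡ Π< g n * Π< h n
Π<-distrib-* g h zero = refl
Π<-distrib-* g h (suc n) rewrite Π<-distrib-* g h n = eq (Π< g n) (Π< h n) (g n) (h n)
  where
  eq : ∀ a b c e → (a * b) * (c * e) ≡ (a * c) * (b * e)
  eq = solve-∀

Π<-tail : ∀ g {m n} → m ≤ n → (∀ k → m ≤ k → g k ≡ 1) → Π< g n ≡ Π< g m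
Π<-tail g {m} m≤n one = go (≤⇒≤′ m≤n)
  where
  go : ∀ {n} → m ≤′ n → Π< g n ≡ Π< g m
  go ≤′-refl       = refl
  go (≤′-step m≤n) = trans (cong₂ _*_ (go m≤n) (one _ (≤′⇒≤ m≤n))) (*-identityʳ _)

Π<-ones : ∀ g n → (∀ k → k < n → g k ≡ 1) → Π< g n ≡ 1
Π<-ones g zero    one = refl
Π<-ones g (suc n) one = trans (cong₂ _*_ (Π<-ones g n (λ k k<n → one k (m<n⇒m<1+n k<n))) (one n ≤-refl)) refl

Π<-single : ∀ p n → p < n → Π< (λ k → choose (k ≟ p) p 1) n ≡ p
Π<-single p n p<n = begin
  Π< h n       ≡⟨ Π<-tail h p<n (λ k p<k → choose-no (k ≟ p) (<⇒≢ p<k ∘ sym)) ⟩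
  Π< h p * h p ≡⟨ cong₂ _*_ (Π<-ones h p (λ k k<p → choose-no (k ≟ p) (<⇒≢ k<p)))
                            (choose-yes (p ≟ p) refl) ⟩
  1 * p        ≡⟨ *-identityˡ p ⟩
  p            ∎
  where
  open ≡-Reasoning
  h = λ k → choose (k ≟ p) p 1

-- Primes and coprimality

prime-divisor : Prime p → q ∣ p → q ≡ 1 ⊎ q ≡ p
prime-divisor pp = prime⇒irreducible pp

prime≢1 : Prime p → p ≢ 1
prime≢1 pp refl = ¬prime[1] pp

prime∣prime : Prime p → Prime q → p ∣ q → p ≡ q
prime∣prime pp pq p∣q with prime-divisor pq p∣q
... | inj₁ p≡1 = contradiction p≡1 (prime≢1 pp)
... | inj₂ p≡q = p≡q

∤⇒coprime : Prime p → ¬ p ∣ k → Coprime k p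
∤⇒coprime pp p∤k {e} (e∣k , e∣p) with prime-divisor pp e∣p
... | inj₁ e≡1  = e≡1
... | inj₂ refl = contradiction e∣k p∤k

coprime⇒∤ : Prime p → Coprime k p → ¬ p ∣ k
coprime⇒∤ pp c p∣k = prime≢1 pp (c (p∣k , ∣-refl))

coprime-∣ˡ : k ∣ l → Coprime l m → Coprime k m
coprime-∣ˡ k∣l c (e∣k , e∣m) = c (∣-trans e∣k k∣l , e∣m)

coprime-∣ʳ : k ∣ l → Coprime m l → Coprime m k
coprime-∣ʳ k∣l c (e∣m , e∣k) = c (e∣m , ∣-trans e∣k k∣l)

coprime-*ʳ : Coprime k m → Coprime k n → Coprime k (m * n)
coprime-*ʳ c c′ (e∣k , e∣mn) = c′ (e∣k , coprime-divisor (coprime-∣ˡ e∣k c) e∣mn)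

coprime-*ˡ : Coprime m k → Coprime n k → Coprime (m * n) k
coprime-*ˡ c c′ = Cop.sym (coprime-*ʳ (Cop.sym c) (Cop.sym c′))

coprime-periodic : Coprime (m + k) m → Coprime k m
coprime-periodic c (e∣k , e∣m) = c (∣m∣n⇒∣m+n e∣m e∣k , e∣m)

coprime-product-∣ : Coprime m n → m ∣ k → n ∣ k → m * n ∣ k
coprime-product-∣ {m} {n} c (divides-refl j) n∣ with coprime-divisor {n} {m} {j} (Cop.sym c) (subst (n ∣_) (*-comm j m) n∣)
... | divides-refl i = divides i (eq i n m)
  where
  eq : ∀ i n m → i * n * m ≡ i * (m * n)
  eq = solve-∀

-- Adding one prime at a time reduces facts about φ and rad to the two cases p ∣ m and p ∤ m, in
-- place of general multiplicativity.
prime-induction : (P : ℕ → Set) → P 1 →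
  (∀ {p m} → Prime p → .{{NonZero m}} → P m → P (m * p)) →
  ∀ n → .{{NonZero n}} → P n
prime-induction P base step n = subst P (sym F.isFactorisation) (go F.factors F.factorsPrime)
  where
  module F = PrimeFactorisation (factorise n)
  go : ∀ ps → All Prime ps → P (product ps)
  go []       []         = base
  go (p ∷ ps) (pp ∷ pps) =
    subst P (*-comm (product ps) p) (step pp {{productOfPrimes≢0 pps}} (go ps pps))

-- Euler's function and the radical

φ≡Σ : ∀ m → φ m ≡ Σ< (λ k → choose (coprime? k m) 1 0) m
φ≡Σ m = length-filter-upTo (λ k → coprime? k m) m

coprimality-periodic : ∀ m k → choose (coprime? (m + k) m) 1 0 ≡ choose (coprime? k m) 1 0
coprimality-periodic m k = choose-cong (coprime? (m + k) m) (coprime? k m) coprime-periodic Cop.coprime-+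

-- Coprimality to m p is here the same as coprimality to m, and the range m p consists of p periods.
φ-*-∣ : Prime p → p ∣ m → φ (m * p) ≡ p * φ m
φ-*-∣ {p} {m} pp p∣m = begin
  φ (m * p)                                          ≡⟨ φ≡Σ (m * p) ⟩
  Σ< (λ k → choose (coprime? k (m * p)) 1 0) (m * p) ≡⟨ Σ<-cong (m * p) (λ k → choose-cong (coprime? k (m * p)) (coprime? k m)
                                                          (coprime-∣ʳ (m∣m*n p)) (λ c → coprime-*ʳ c (coprime-∣ʳ p∣m c))) ⟩
  Σ< g (m * p)                                       ≡⟨ cong (Σ< g) (*-comm m p) ⟩
  Σ< g (p * m)                                       ≡⟨ Σ<-periodic g m (coprimality-periodic m) p ⟩
  p * Σ< g m                                         ≡⟨ cong (p *_) (φ≡Σ m) ⟨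
  p * φ m                                            ∎
  where
  open ≡-Reasoning
  g = λ k → choose (coprime? k m) 1 0

-- Among the numbers below m p there are p φ(m) prime to m; those divisible by p are the k p with k
-- prime to m, φ(m) in number. They are added on the left instead of subtracted on the right.
φ-*-∤ : Prime (suc r) → ¬ suc r ∣ m → φ (m * suc r) ≡ r * φ m
φ-*-∤ {r} {m} pp p∤m = +-cancelʳ-≡ (φ m) _ _ $ begin
  φ (m * ρ) + φ m                                         ≡⟨ cong₂ _+_ (φ≡Σ (m * ρ)) (φ≡Σ m) ⟩
  Σ< g′ (m * ρ) + Σ< g m                                  ≡⟨ cong (Σ< g′ (m * ρ) +_) (Σ<-cong m (λ k →
                                                               choose-cong (coprime? k m) (coprime? (k * ρ) m)
                                                                 (λ c → coprime-*ˡ c (Cop.sym (∤⇒coprime pp p∤m))) (coprime-∣ˡ (m∣m*n ρ)))) ⟩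
  Σ< g′ (m * ρ) + Σ< (λ k → g (k * ρ)) m                  ≡⟨ cong (Σ< g′ (m * ρ) +_) (Σ<-multiples g m r) ⟨
  Σ< g′ (m * ρ) + Σ< (λ k → choose (ρ ∣? k) (g k) 0) (m * ρ) ≡⟨ Σ<-distrib-+ g′ _ (m * ρ) ⟨
  Σ< (λ k → g′ k + choose (ρ ∣? k) (g k) 0) (m * ρ)       ≡⟨ Σ<-cong (m * ρ) split ⟩
  Σ< g (m * ρ)                                            ≡⟨ cong (Σ< g) (*-comm m ρ) ⟩
  Σ< g (ρ * m)                                            ≡⟨ Σ<-periodic g m (coprimality-periodic m) ρ ⟩
  ρ * Σ< g m                                              ≡⟨ cong (ρ *_) (φ≡Σ m) ⟨
  φ m + r * φ m                                           ≡⟨ +-comm (φ m) (r * φ m) ⟩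
  r * φ m + φ m                                           ∎
  where
  open ≡-Reasoning
  ρ  = suc r
  g  = λ k → choose (coprime? k m) 1 0
  g′ = λ k → choose (coprime? k (m * ρ)) 1 0
  split : ∀ k → g′ k + choose (ρ ∣? k) (g k) 0 ≡ g k
  split k = go (ρ ∣? k)
    where
    go : Dec (ρ ∣ k) → g′ k + choose (ρ ∣? k) (g k) 0 ≡ g k
    go (yes p∣k) = cong₂ _+_
      (choose-no (coprime? k (m * ρ)) (λ c → coprime⇒∤ pp (coprime-∣ʳ (n∣m*n m) c) p∣k))
      (choose-yes (ρ ∣? k) p∣k)
    go (no p∤k) = trans (cong₂ _+_
      (choose-cong (coprime? k (m * ρ)) (coprime? k m)
        (coprime-∣ʳ (m∣m*n ρ)) (λ c → coprime-*ʳ c (∤⇒coprime pp p∤k)))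
      (choose-no (ρ ∣? k) p∤k)) (+-identityʳ _)

primeFactor : ℕ → ℕ → ℕ
primeFactor m k = choose (prime? k ×-dec (k ∣? m)) k 1

rad≡Π : ∀ m n → .{{NonZero m}} → m < n → rad m ≡ Π< (primeFactor m) n
rad≡Π m n m<n = trans (product-filter-upTo (λ k → prime? k ×-dec (k ∣? m)) (suc m))
  (sym (Π<-tail (primeFactor m) m<n
    (λ k m<k → choose-no (prime? k ×-dec (k ∣? m)) (>⇒∤ m<k ∘ proj₂))))

rad-*-∣ : .{{NonZero m}} → Prime p → p ∣ m → rad (m * p) ≡ rad m
rad-*-∣ {m} {p} pp p∣m = begin
  rad (m * p)                           ≡⟨ rad≡Π (m * p) (suc (m * p)) ≤-refl ⟩
  Π< (primeFactor (m * p)) (suc (m * p)) ≡⟨ Π<-cong (suc (m * p)) (λ k → choose-cong (prime? k ×-dec (k ∣? (m * p))) (prime? k ×-dec (k ∣? m))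
        (λ (pk , k∣mp) → pk , [ id , (λ k∣p → ∣-trans k∣p p∣m) ]′ (euclidsLemma m p pk k∣mp))
        (λ (pk , k∣m) → pk , ∣m⇒∣m*n p k∣m)) ⟩
  Π< (primeFactor m) (suc (m * p))      ≡⟨ rad≡Π m (suc (m * p)) (s≤s (m≤m*n m p)) ⟨
  rad m                                 ∎
  where
  open ≡-Reasoning
  instance
    p≢0 = prime⇒nonZero pp
    mp≢0 = m*n≢0 m p

rad-*-∤ : .{{NonZero m}} → Prime p → ¬ p ∣ m → rad (m * p) ≡ rad m * p
rad-*-∤ {m} {p} pp p∤m = begin
  rad (m * p)                                               ≡⟨ rad≡Π (m * p) (suc (m * p)) ≤-refl ⟩
  Π< (primeFactor (m * p)) (suc (m * p))                    ≡⟨ Π<-cong (suc (m * p)) split ⟩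
  Π< (λ k → primeFactor m k * choose (k ≟ p) p 1) (suc (m * p)) ≡⟨ Π<-distrib-* (primeFactor m) _ (suc (m * p)) ⟩
  Π< (primeFactor m) (suc (m * p)) * Π< (λ k → choose (k ≟ p) p 1) (suc (m * p))
    ≡⟨ cong₂ _*_ (sym (rad≡Π m (suc (m * p)) (s≤s (m≤m*n m p)))) (Π<-single p _ (s≤s (m≤n*m p m))) ⟩
  rad m * p                                                 ∎
  where
  open ≡-Reasoning
  instance
    p≢0 = prime⇒nonZero pp
    mp≢0 = m*n≢0 m p
  split : ∀ k → primeFactor (m * p) k ≡ primeFactor m k * choose (k ≟ p) p 1
  split k = go (k ≟ p)
    where
    go : Dec (k ≡ p) → primeFactor (m * p) k ≡ primeFactor m k * choose (k ≟ p) p 1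
    go (yes refl) = trans (choose-yes (prime? k ×-dec (k ∣? (m * k))) (pp , n∣m*n m))
      (sym (trans (cong₂ _*_ (choose-no (prime? k ×-dec (k ∣? m)) (p∤m ∘ proj₂)) (choose-yes (k ≟ k) refl))
                  (*-identityˡ k)))
    go (no k≢p) = sym (trans (cong₂ _*_
      (choose-cong (prime? k ×-dec (k ∣? m)) (prime? k ×-dec (k ∣? (m * p)))
        (λ (pk , k∣m) → pk , ∣m⇒∣m*n p k∣m)
        (λ (pk , k∣mp) → pk , [ id , (λ k∣p → contradiction (prime∣prime pk pp k∣p) k≢p) ]′ (euclidsLemma m p pk k∣mp)))
      (choose-no (k ≟ p) k≢p)) (*-identityʳ _))

rad-∣ : ∀ n → .{{NonZero n}} → rad n ∣ n
rad-∣ = prime-induction (λ n → rad n ∣ n) ∣-refl step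
  where
  step : ∀ {p m} → Prime p → .{{NonZero m}} → rad m ∣ m → rad (m * p) ∣ m * p
  step {p} {m} pp r∣m with p ∣? m
  ... | yes p∣m rewrite rad-*-∣ pp p∣m = ∣m⇒∣m*n p r∣m
  ... | no  p∤m rewrite rad-*-∤ pp p∤m = *-monoˡ-∣ p r∣m

rad≢0 : ∀ n → .{{NonZero n}} → NonZero (rad n)
rad≢0 n = ≢-nonZero λ rad≡0 → ≢-nonZero⁻¹ n (0∣⇒≡0 (subst (_∣ n) rad≡0 (rad-∣ n)))

-- Says φ(n)/n = φ(rad n)/rad n with denominators cleared; all later divisions by n/rad n go through
-- this form.
φ-rad : ∀ n → .{{NonZero n}} → φ n * rad n ≡ n * φ (rad n)
φ-rad = prime-induction (λ n → φ n * rad n ≡ n * φ (rad n)) refl step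
  where
  open ≡-Reasoning
  step : ∀ {p m} → Prime p → .{{NonZero m}} → φ m * rad m ≡ m * φ (rad m) →
    φ (m * p) * rad (m * p) ≡ m * p * φ (rad (m * p))
  step {zero} pp = contradiction pp ¬prime[0]
  step {p@(suc r)} {m} pp ih with p ∣? m
  ... | yes p∣m rewrite rad-*-∣ pp p∣m | φ-*-∣ pp p∣m = begin
    p * φ m * rad m     ≡⟨ *-assoc p (φ m) (rad m) ⟩
    p * (φ m * rad m)   ≡⟨ cong (p *_) ih ⟩
    p * (m * φ (rad m)) ≡⟨ *-assoc p m (φ (rad m)) ⟨
    p * m * φ (rad m)   ≡⟨ cong (_* φ (rad m)) (*-comm p m) ⟩
    m * p * φ (rad m)   ∎
  ... | no  p∤m rewrite rad-*-∤ pp p∤m | φ-*-∤ pp p∤m | φ-*-∤ pp (p∤m ∘ (λ p∣r → ∣-trans p∣r (rad-∣ m))) = begin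
    r * φ m * (rad m * p)   ≡⟨ eq₁ r (φ m) (rad m) p ⟩
    r * p * (φ m * rad m)   ≡⟨ cong (r * p *_) ih ⟩
    r * p * (m * φ (rad m)) ≡⟨ eq₂ r p m (φ (rad m)) ⟩
    m * p * (r * φ (rad m)) ∎
    where
    eq₁ : ∀ a b c e → a * b * (c * e) ≡ a * e * (b * c)
    eq₁ = solve-∀
    eq₂ : ∀ a b c e → a * b * (c * e) ≡ c * b * (a * e)
    eq₂ = solve-∀

φ≤ : ∀ n → φ n ≤ n
φ≤ n = ≤-trans (length-filter (λ k → coprime? k n) (upTo n)) (≤-reflexive (length-upTo n))

rad-supported : ∀ n k → .{{NonZero n}} → .{{NonZero k}} →
  (∀ {p} → Prime p → p ∣ k → p ∣ n) → rad (n * k) ≡ rad n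
rad-supported n k = prime-induction (λ k → (∀ {p} → Prime p → p ∣ k → p ∣ n) → rad (n * k) ≡ rad n)
  (λ _ → cong rad (*-identityʳ n)) step k
  where
  step : ∀ {p m} → Prime p → .{{NonZero m}} → ((∀ {p} → Prime p → p ∣ m → p ∣ n) → rad (n * m) ≡ rad n) →
    (∀ {q} → Prime q → q ∣ m * p → q ∣ n) → rad (n * (m * p)) ≡ rad n
  step {p} {m} pp ih sup = trans (cong rad (sym (*-assoc n m p)))
    (trans (rad-*-∣ {{m*n≢0 n m}} pp (∣m⇒∣m*n m (sup pp (n∣m*n m)))) (ih (λ pq q∣m → sup pq (∣m⇒∣m*n p q∣m))))

rad-* : ∀ n k → .{{NonZero n}} → .{{NonZero k}} → Coprime n k → rad (n * k) ≡ rad n * rad k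
rad-* n k = prime-induction (λ k → Coprime n k → rad (n * k) ≡ rad n * rad k)
  (λ _ → trans (cong rad (*-identityʳ n)) (sym (*-identityʳ (rad n)))) step k
  where
  step : ∀ {p m} → Prime p → .{{NonZero m}} → (Coprime n m → rad (n * m) ≡ rad n * rad m) →
    Coprime n (m * p) → rad (n * (m * p)) ≡ rad n * rad (m * p)
  step {p} {m} pp ih c with p ∣? m
  ... | yes p∣m rewrite rad-*-∣ pp p∣m = trans (cong rad (sym (*-assoc n m p)))
    (trans (rad-*-∣ {{m*n≢0 n m}} pp (∣n⇒∣m*n n p∣m)) (ih (coprime-∣ʳ (m∣m*n p) c)))
  ... | no  p∤m rewrite rad-*-∤ pp p∤m = trans (cong rad (sym (*-assoc n m p)))
    (trans (rad-*-∤ {{m*n≢0 n m}} pp (λ p∣nm → [ coprime⇒∤ pp (coprime-∣ʳ (n∣m*n m) c) , p∤m ]′ (euclidsLemma n m pp p∣nm)))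
    (trans (cong (_* p) (ih (coprime-∣ʳ (m∣m*n p) c))) (*-assoc (rad n) (rad m) p)))

-- Serves for parity: an odd prime factor of n makes φ(rad n) even.
prime∣⇒∣φ[rad] : Prime (suc r) → ∀ n → .{{NonZero n}} → suc r ∣ n → r ∣ φ (rad n)
prime∣⇒∣φ[rad] {r} pl n = prime-induction (λ n → suc r ∣ n → r ∣ φ (rad n))
  (λ l∣1 → contradiction (∣1⇒≡1 l∣1) (prime≢1 pl)) step n
  where
  step : ∀ {p m} → Prime p → .{{NonZero m}} → (suc r ∣ m → r ∣ φ (rad m)) → suc r ∣ m * p → r ∣ φ (rad (m * p))
  step {zero} pp = contradiction pp ¬prime[0]
  step {p@(suc s)} {m} pp ih l∣mp with p ∣? m
  ... | yes p∣m rewrite rad-*-∣ pp p∣m = ih ([ id , (λ l∣p → ∣-trans l∣p p∣m) ]′ (euclidsLemma m p pl l∣mp))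
  ... | no  p∤m rewrite rad-*-∤ pp p∤m | φ-*-∤ pp (p∤m ∘ (λ p∣r → ∣-trans p∣r (rad-∣ m)))
    with euclidsLemma m p pl l∣mp
  ...   | inj₁ l∣m = ∣n⇒∣m*n s (ih l∣m)
  ...   | inj₂ l∣p with refl ← prime∣prime pl pp l∣p = m∣m*n (φ (rad m))

-- Congruences

infix 4 _≅_[mod_]
-- Multiples are allowed on both sides, so that the relation is symmetric and needs no subtraction.
record _≅_[mod_] (a b m : ℕ) : Set where
  constructor ≅-intro
  field
    s t   : ℕ
    shift : a + s * m ≡ b + t * m

≅-refl : a ≅ a [mod m ]
≅-refl = ≅-intro 0 0 refl

≅-reflexive : a ≡ b → a ≅ b [mod m ]
≅-reflexive refl = ≅-refl

≅-sym : a ≅ b [mod m ] → b ≅ a [mod m ]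
≅-sym (≅-intro s t eq) = ≅-intro t s (sym eq)

≅-trans : a ≅ b [mod m ] → b ≅ c [mod m ] → a ≅ c [mod m ]
≅-trans {a} {b} {m} {c} (≅-intro s t eq) (≅-intro u v eq′) = ≅-intro (s + u) (v + t) (begin
  a + (s + u) * m       ≡⟨ eq₁ a s u m ⟩
  (a + s * m) + u * m   ≡⟨ cong (_+ u * m) eq ⟩
  (b + t * m) + u * m   ≡⟨ eq₂ b t u m ⟩
  (b + u * m) + t * m   ≡⟨ cong (_+ t * m) eq′ ⟩
  (c + v * m) + t * m   ≡⟨ eq₁ c v t m ⟨
  c + (v + t) * m       ∎)
  where
  open ≡-Reasoning
  eq₁ : ∀ a s u m → a + (s + u) * m ≡ (a + s * m) + u * m
  eq₁ = solve-∀
  eq₂ : ∀ b t u m → (b + t * m) + u * m ≡ (b + u * m) + t * m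
  eq₂ = solve-∀

≅-+ : a ≅ b [mod m ] → a′ ≅ b′ [mod m ] → a + a′ ≅ b + b′ [mod m ]
≅-+ {a} {b} {m} {a′} {b′} (≅-intro s t eq) (≅-intro u v eq′) = ≅-intro (s + u) (t + v) (begin
  a + a′ + (s + u) * m         ≡⟨ eq₁ a a′ s u m ⟩
  (a + s * m) + (a′ + u * m)   ≡⟨ cong₂ _+_ eq eq′ ⟩
  (b + t * m) + (b′ + v * m)   ≡⟨ eq₁ b b′ t v m ⟨
  b + b′ + (t + v) * m         ∎)
  where
  open ≡-Reasoning
  eq₁ : ∀ a c s u m → a + c + (s + u) * m ≡ (a + s * m) + (c + u * m)
  eq₁ = solve-∀

≅-* : a ≅ b [mod m ] → a′ ≅ b′ [mod m ] → a * a′ ≅ b * b′ [mod m ]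
≅-* {a} {b} {m} {a′} {b′} (≅-intro s t eq) (≅-intro u v eq′) =
  ≅-intro (s * a′ + a * u + s * u * m) (t * b′ + b * v + t * v * m) (begin
  a * a′ + (s * a′ + a * u + s * u * m) * m ≡⟨ eq₁ a a′ s u m ⟩
  (a + s * m) * (a′ + u * m)                ≡⟨ cong₂ _*_ eq eq′ ⟩
  (b + t * m) * (b′ + v * m)                ≡⟨ eq₁ b b′ t v m ⟨
  b * b′ + (t * b′ + b * v + t * v * m) * m ∎)
  where
  open ≡-Reasoning
  eq₁ : ∀ a c s u m → a * c + (s * c + a * u + s * u * m) * m ≡ (a + s * m) * (c + u * m)
  eq₁ = solve-∀

≅-^ : ∀ n → a ≅ b [mod m ] → a ^ n ≅ b ^ n [mod m ]
≅-^ zero    eq = ≅-refl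
≅-^ (suc n) eq = ≅-* eq (≅-^ n eq)

≅1-^ : ∀ n → a ≅ 1 [mod m ] → a ^ n ≅ 1 [mod m ]
≅1-^ n eq = ≅-trans (≅-^ n eq) (≅-reflexive (^-zeroˡ n))

≅⇒∣ : a ≅ b [mod m ] → m ∣ ∣ a - b ∣
≅⇒∣ {a} {b} {m} (≅-intro s t eq) = divides ∣ t - s ∣ (begin
  ∣ a - b ∣                     ≡⟨ ∣m+n-m+o∣≡∣n-o∣ (s * m) a b ⟨
  ∣ s * m + a - s * m + b ∣     ≡⟨ cong₂ ∣_-_∣ (trans (+-comm (s * m) a) eq) (+-comm (s * m) b) ⟩
  ∣ b + t * m - b + s * m ∣     ≡⟨ ∣m+n-m+o∣≡∣n-o∣ b (t * m) (s * m) ⟩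
  ∣ t * m - s * m ∣             ≡⟨ *-distribʳ-∣-∣ m t s ⟨
  ∣ t - s ∣ * m                 ∎)
  where open ≡-Reasoning

∣⇒≅ : m ∣ ∣ a - b ∣ → a ≅ b [mod m ]
∣⇒≅ {m} {a} {b} (divides q eq) with ≤-total a b
... | inj₁ a≤b = ≅-intro q 0 (trans (cong (a +_) (trans (sym eq) (m≤n⇒∣m-n∣≡n∸m a≤b)))
                   (trans (m+[n∸m]≡n a≤b) (sym (+-identityʳ b))))
... | inj₂ b≤a = ≅-intro 0 q (trans (+-identityʳ a) (sym (trans (cong (b +_) (trans (sym eq) (m≤n⇒∣n-m∣≡n∸m b≤a)))
                   (m+[n∸m]≡n b≤a))))

≅-∣-modulus : l ∣ m → a ≅ b [mod m ] → a ≅ b [mod l ]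
≅-∣-modulus l∣m eq = ∣⇒≅ (∣-trans l∣m (≅⇒∣ eq))

∣⇒≅0 : m ∣ a → a ≅ 0 [mod m ]
∣⇒≅0 {m} {a} m∣a = ∣⇒≅ (subst (m ∣_) (sym (∣-∣-identityʳ a)) m∣a)

≅0⇒∣ : a ≅ 0 [mod m ] → m ∣ a
≅0⇒∣ {a} {m} eq = subst (m ∣_) (∣-∣-identityʳ a) (≅⇒∣ eq)

≅-mod1 : ∀ a b → a ≅ b [mod 1 ]
≅-mod1 a b = ∣⇒≅ (1∣ _)

≅-combine : Coprime m n → a ≅ b [mod m ] → a ≅ b [mod n ] → a ≅ b [mod m * n ]
≅-combine c eq eq′ = ∣⇒≅ (coprime-product-∣ c (≅⇒∣ eq) (≅⇒∣ eq′))

≅-% : ∀ a m .{{_ : NonZero m}} → a % m ≅ a [mod m ]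
≅-% a m = ≅-intro (a / m) 0 (trans (sym (m≡m%n+[m/n]*n a m)) (sym (+-identityʳ a)))

≅-cancel : Prime p → ¬ p ∣ c → c * a ≅ c * b [mod p ] → a ≅ b [mod p ]
≅-cancel {p} {c} {a} {b} pp p∤c eq = ∣⇒≅ ([ (λ p∣c → contradiction p∣c p∤c) , id ]′
  (euclidsLemma c ∣ a - b ∣ pp (subst (p ∣_) (sym (*-distribˡ-∣-∣ c a b)) (≅⇒∣ eq))))

coprime-≅ : a ≅ b [mod m ] → Coprime a m → Coprime b m
coprime-≅ {a} {b} {m} (≅-intro s t eq) c {e} (e∣b , e∣m) =
  c (∣m+n∣m⇒∣n (subst (e ∣_) (trans (sym eq) (+-comm a (s * m))) (∣m∣n⇒∣m+n e∣b (∣n⇒∣m*n t e∣m))) (∣n⇒∣m*n s e∣m) , e∣m)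

-- Theorems of Fermat and Euler

-- The number of terms is a parameter: Pascal's rule is proved by induction on it, and Fermat's
-- theorem needs the sum without its top term.
partialBinomial : ℕ → ℕ → ℕ → ℕ
partialBinomial n x = Σ< (λ k → (n 𝐂 k) * x ^ k)

partialBinomial-suc : ∀ n x j →
  partialBinomial (suc n) x (suc j) ≡ partialBinomial n x (suc j) + x * partialBinomial n x j
partialBinomial-suc n x zero    = cong (1 +_) (sym (*-zeroʳ x))
partialBinomial-suc n x (suc j) = begin
  B′ (suc j) + (suc n 𝐂 suc j) * x ^ suc j ≡⟨ cong₂ (λ u v → u + v * x ^ suc j)
                                              (partialBinomial-suc n x j) (sym (nCk+nC[k+1]≡[n+1]C[k+1] n j)) ⟩
  B (suc j) + x * B j + ((n 𝐂 j) + (n 𝐂 suc j)) * (x * x ^ j) ≡⟨ eq (B (suc j)) (B j) x (n 𝐂 j) (n 𝐂 suc j) (x ^ j) ⟩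
  B (suc j) + (n 𝐂 suc j) * (x * x ^ j) + x * (B j + (n 𝐂 j) * x ^ j) ∎
  where
  open ≡-Reasoning
  B  = partialBinomial n x
  B′ = partialBinomial (suc n) x
  eq : ∀ u v x y z w → u + x * v + (y + z) * (x * w) ≡ u + z * (x * w) + x * (v + y * w)
  eq = solve-∀

binomial : ∀ n x → (1 + x) ^ n ≡ partialBinomial n x (suc n)
binomial zero    x = refl
binomial (suc n) x = begin
  (1 + x) * (1 + x) ^ n                       ≡⟨ cong ((1 + x) *_) (binomial n x) ⟩
  -- The vanishing term of index n + 1 is added, because Pascal's rule pairs a sum with one that is
  -- a term shorter.
  B (suc n) + x * B (suc n)                   ≡⟨ cong (_+ x * B (suc n)) (trans (cong (λ c → B (suc n) + c * x ^ suc n) (k>n⇒nCk≡0 (n<1+n n))) (+-identityʳ _)) ⟨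
  B (suc (suc n)) + x * B (suc n)             ≡⟨ partialBinomial-suc n x (suc n) ⟨
  partialBinomial (suc n) x (suc (suc n))     ∎
  where
  open ≡-Reasoning
  B = partialBinomial n x

absorption : ∀ n k → suc k * (suc n 𝐂 suc k) ≡ suc n * (n 𝐂 k)
absorption n zero = trans (*-identityˡ _) (trans (nC1≡n (suc n)) (sym (*-identityʳ (suc n))))
absorption zero (suc k) = trans (cong (suc (suc k) *_) (k>n⇒nCk≡0 {1} {2 + k} (s≤s (s≤s z≤n))))
  (trans (*-zeroʳ (suc (suc k))) (sym (trans (*-identityˡ _) (k>n⇒nCk≡0 {0} {suc k} (s≤s z≤n)))))
absorption (suc n) (suc k) = begin
  (2 + k) * (suc (suc n) 𝐂 suc (suc k))                     ≡⟨ cong ((2 + k) *_) (nCk+nC[k+1]≡[n+1]C[k+1] (suc n) (suc k)) ⟨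
  (2 + k) * (u + (suc n 𝐂 suc (suc k)))                       ≡⟨ eq₁ k u (suc n 𝐂 suc (suc k)) ⟩
  (u + suc k * u) + (2 + k) * (suc n 𝐂 suc (suc k))         ≡⟨ cong₂ (λ y z → u + y + z) (absorption n k) (absorption n (suc k)) ⟩
  (u + suc n * (n 𝐂 k)) + suc n * (n 𝐂 suc k)               ≡⟨ eq₂ u (suc n) (n 𝐂 k) (n 𝐂 suc k) ⟩
  u + suc n * ((n 𝐂 k) + (n 𝐂 suc k))                           ≡⟨ cong (λ z → u + suc n * z) (nCk+nC[k+1]≡[n+1]C[k+1] n k) ⟩
  u + suc n * u                                             ∎
  where
  open ≡-Reasoning
  u = suc n 𝐂 suc k
  eq₁ : ∀ k u v → (2 + k) * (u + v) ≡ (u + suc k * u) + (2 + k) * v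
  eq₁ = solve-∀
  eq₂ : ∀ u n y z → (u + n * y) + n * z ≡ u + n * (y + z)
  eq₂ = solve-∀

prime∣binomial : Prime p → suc k < p → p ∣ p 𝐂 suc k
prime∣binomial {zero} pp = contradiction pp ¬prime[0]
prime∣binomial {suc r} {k} pp k<r = [ (λ p∣ → contradiction p∣ (>⇒∤ k<r)) , id ]′
  (euclidsLemma (suc k) (suc r 𝐂 suc k) pp (divides (r 𝐂 k) (trans (absorption r k) (*-comm (suc r) (r 𝐂 k)))))

-- Induction on x: modulo p the inner binomial coefficients vanish, so (1 + x)^p ≡ 1 + x^p.
fermat : Prime p → ∀ x → x ^ p ≅ x [mod p ]
fermat {zero} pp = contradiction pp ¬prime[0]
fermat {suc r} pp zero = ≅-refl
fermat {p@(suc r)} pp (suc x) = ≅-trans (≅-reflexive (binomial p x))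
  (≅-+ (go r ≤-refl) (≅-trans (≅-reflexive (trans (cong (_* x ^ p) (nCn≡1 p)) (*-identityˡ (x ^ p)))) (fermat pp x)))
  where
  go : ∀ j → j < p → partialBinomial p x (suc j) ≅ 1 [mod p ]
  go zero    j<p = ≅-refl
  go (suc j) j<p = ≅-trans
    (≅-+ (go j (<-trans (n<1+n j) j<p)) (∣⇒≅0 (∣m⇒∣m*n (x ^ suc j) (prime∣binomial pp j<p)))) ≅-refl

fermat′ : Prime (suc r) → Coprime k (suc r) → k ^ r ≅ 1 [mod suc r ]
fermat′ {r} {k} pp c = ≅-cancel pp (coprime⇒∤ pp c)
  (≅-trans (fermat pp k) (≅-reflexive (sym (*-identityʳ k))))

-- The binomial expansion modulo m², with `z` collecting the terms of order two and higher.
power-expansion : ∀ t m j → ∃[ z ] (1 + t * m) ^ j ≡ 1 + m * (j * t + m * z)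
power-expansion t m zero = 0 , eq m
  where
  eq : ∀ m → 1 ≡ 1 + m * (m * 0)
  eq = solve-∀
power-expansion t m (suc j) with z , ih ← power-expansion t m j =
  z + j * t * t + t * m * z , trans (cong ((1 + t * m) *_) ih) (eq t m j z)
  where
  eq : ∀ t m j z → (1 + t * m) * (1 + m * (j * t + m * z)) ≡ 1 + m * ((t + j * t) + m * (z + j * t * t + t * m * z))
  eq = solve-∀

-- Writing a = 1 + t m, the linear term p t m of a^p is divisible by m p, and the rest by m², hence
-- by m p because p ∣ m.
≅1-lift : Prime p → p ∣ m → a ≅ 1 [mod m ] → a ^ p ≅ 1 [mod m * p ]
≅1-lift {p} {m} {zero} pp p∣m eq =
  contradiction (∣1⇒≡1 (∣-trans p∣m (≅⇒∣ eq))) (prime≢1 pp)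
≅1-lift {p} {_} {suc a} pp (divides-refl m′) eq
  with divides-refl t ← subst (m′ * p ∣_) (∣-∣-identityʳ a) (≅⇒∣ eq)
  with z , eq′ ← power-expansion t (m′ * p) p =
  ≅-intro 0 (t + m′ * z) (trans (+-identityʳ _) (trans eq′ (eq₃ m′ p t z)))
  where
  eq₃ : ∀ m′ p t z → 1 + m′ * p * (p * t + m′ * p * z) ≡ 1 + (t + m′ * z) * (m′ * p * p)
  eq₃ = solve-∀

-- The exponent of (ℤ/m)* divides e. All integers prime to m are allowed, not only those listed in
-- `units`, so that a change of modulus requires no reduction.
record Kills (m e : ℕ) : Set where
  constructor kills
  field power≅1 : ∀ k → Coprime k m → k ^ e ≅ 1 [mod m ]

open Kills

kills-∣ : k ∣ l → Kills m k → Kills m l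
kills-∣ {k} (divides-refl j) kill = kills λ x c →
  ≅-trans (≅-reflexive (trans (cong (x ^_) (*-comm j k)) (sym (^-*-assoc x k j)))) (≅1-^ j (power≅1 kill x c))

kills-* : Coprime m n → Kills m l → Kills n l → Kills (m * n) l
kills-* {m} {n} c kill kill′ = kills λ x c′ →
  ≅-combine c (power≅1 kill x (coprime-∣ʳ (m∣m*n n) c′)) (power≅1 kill′ x (coprime-∣ʳ (n∣m*n m) c′))

fermat-kills : Prime (suc r) → Kills (suc r) r
fermat-kills pp = kills λ x c → fermat′ pp c

euler : ∀ m → .{{NonZero m}} → Kills m (φ m)
euler = prime-induction (λ m → Kills m (φ m)) (kills λ _ _ → ≅-mod1 _ _) step
  where
  step : ∀ {p m} → Prime p → .{{NonZero m}} → Kills m (φ m) → Kills (m * p) (φ (m * p))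
  step {zero} pp = contradiction pp ¬prime[0]
  step {p@(suc r)} {m} pp ih with p ∣? m
  ... | yes p∣m rewrite φ-*-∣ pp p∣m | *-comm p (φ m) = kills λ x c →
    ≅-trans (≅-reflexive (sym (^-*-assoc x (φ m) p))) (≅1-lift pp p∣m (power≅1 ih x (coprime-∣ʳ (m∣m*n p) c)))
  ... | no  p∤m rewrite φ-*-∤ pp p∤m = kills-* (∤⇒coprime pp p∤m)
    (kills-∣ (n∣m*n r) ih) (kills-∣ (m∣m*n (φ m)) (fermat-kills pp))

-- The Carmichael function

-- The enumeration `g` is arbitrary because the recursion passes to `g ∘ suc`.
first : ∀ {P : ℕ → Set} (P? : Decidable P) (g : ℕ → ℕ) n z {i} → i < n → P (g i) →
  ∃[ j ] fromMaybe z (head (filter P? (applyUpTo g n))) ≡ g j × P (g j) × (∀ i → i < j → ¬ P (g i))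
first P? g (suc n) z {i} i<n Pi with P? (g 0)
... | yes P0 = 0 , refl , P0 , λ _ ()
first P? g (suc n) z {zero}  i<n Pi | no ¬P0 = contradiction Pi ¬P0
first {P} P? g (suc n) z {suc i} i<n Pi | no ¬P0
  with j , eq , Pj , least ← first P? (g ∘ suc) n z (s<s⁻¹ i<n) Pi = suc j , eq , Pj , least′
  where
  least′ : ∀ i → i < suc j → ¬ P (g i)
  least′ zero    _   = ¬P0
  least′ (suc i) i<j = least i (s<s⁻¹ i<j)

kills⇒annihilates : Kills m l → Annihilates m l
kills⇒annihilates {m} kill = All.tabulate λ {k} k∈ →
  ≅⇒∣ (power≅1 kill k (proj₂ {A = k ∈ upTo m} (∈-filter⁻ (λ k → coprime? k m) {xs = upTo m} k∈)))

annihilates⇒kills : .{{NonZero m}} → Annihilates m l → Kills m l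
annihilates⇒kills {m} {e} ann = kills λ x c → ≅-trans (≅-^ e (≅-sym (≅-% x m)))
  (∣⇒≅ (All.lookup ann (∈-filter⁺ (λ k → coprime? k m) (∈-upTo⁺ (m%n<n x m)) (coprime-≅ (≅-sym (≅-% x m)) c))))

carmichael-spec : ∀ m → .{{NonZero m}} → ∃[ j ] carmichael m ≡ suc j ×
  Kills m (suc j) × (∀ i → i < j → ¬ Kills m (suc i))
carmichael-spec m with φ m in eq | φ-nonZero m
... | suc n | _ with j , eq′ , ann , least ← first (annihilates? m) suc (suc n) (suc n) (n<1+n n)
                      (kills⇒annihilates (subst (Kills m) eq (euler m)))
  = j , eq′ , annihilates⇒kills ann , λ i i<j kill → least i i<j (kills⇒annihilates kill)

-- A remainder of two killing exponents kills as well. Being smaller than the divisor, it must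
-- vanish when the divisor is minimal, which yields divisibility both for λ(m) and for p - 1.
kills-% : ∀ {e E} .{{_ : NonZero e}} → Kills m e → Kills m E → Kills m (E % e)
kills-% {m} {e} {E} kill kill′ = kills λ x c → ≅-trans (≅-sym (reduce x c)) (power≅1 kill′ x c)
  where
  reduce : ∀ x → Coprime x m → x ^ E ≅ x ^ (E % e) [mod m ]
  reduce x c = ≅-trans (≅-reflexive (trans (cong (x ^_) (m≡m%n+[m/n]*n E e)) (^-distribˡ-+-* x (E % e) (E / e * e))))
    (≅-trans (≅-* (≅-refl {x ^ (E % e)}) (power≅1 (kills-∣ (n∣m*n (E / e)) kill) x c)) (≅-reflexive (*-identityʳ _)))

carmichael-kills : ∀ m → .{{NonZero m}} → Kills m (carmichael m)
carmichael-kills m with j , eq , kill , _ ← carmichael-spec m = subst (Kills m) (sym eq) kill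

carmichael-∣ : ∀ m → .{{NonZero m}} → ∀ {e} → Kills m e → carmichael m ∣ e
carmichael-∣ m {e} kill with j , eq , kill′ , least ← carmichael-spec m = subst (_∣ e) (sym eq) (go (e % suc j) refl)
  where
  go : ∀ i → e % suc j ≡ i → suc j ∣ e
  go zero    eq = m%n≡0⇒n∣m e (suc j) eq
  go (suc i) eq = contradiction (subst (Kills m) eq (kills-% kill′ kill))
    (least i (s<s⁻¹ (subst (_< suc j) eq (m%n<n e (suc j)))))

-- Monic (suc n) f says that f(x) − f(r) = (x − r)·g(x) for some monic g of
-- degree n, moved around so that no subtraction occurs.
Monic : ℕ → (ℕ → ℕ) → Set
Monic zero    f = ∀ x → f x ≡ 1
Monic (suc n) f = ∀ r → ∃[ g ] Monic n g × (∀ x → f x + r * g x ≡ f r + x * g x)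

-- If f(x) - f(r) = (x - r) g(x), then the quotient belonging to x f(x) + c is x g(x) + f(r), again
-- a Horner step.
monic-horner : ∀ n {f} → Monic n f → ∀ c → Monic (suc n) (λ x → x * f x + c)
monic-horner zero {f} one c r = (λ _ → 1) , (λ _ → refl) , λ x → begin
  x * f x + c + r * 1 ≡⟨ cong (λ y → x * y + c + r * 1) (one x) ⟩
  x * 1 + c + r * 1   ≡⟨ eq x r c ⟩
  r * 1 + c + x * 1   ≡⟨ cong (λ y → r * y + c + x * 1) (one r) ⟨
  r * f r + c + x * 1 ∎
  where
  open ≡-Reasoning
  eq : ∀ x r c → x * 1 + c + r * 1 ≡ r * 1 + c + x * 1
  eq = solve-∀
monic-horner (suc n) {f} monic c r with g , monic-g , eq ← monic r =
  (λ x → x * g x + f r) , monic-horner n monic-g (f r) , λ x → begin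
  x * f x + c + r * (x * g x + f r)   ≡⟨ eq₁ x (f x) c r (g x) (f r) ⟩
  x * (f x + r * g x) + r * f r + c   ≡⟨ cong (λ y → x * y + r * f r + c) (eq x) ⟩
  x * (f r + x * g x) + r * f r + c   ≡⟨ eq₂ x (f r) (g x) r c ⟩
  r * f r + c + x * (x * g x + f r)   ∎
  where
  open ≡-Reasoning
  eq₁ : ∀ x u c r g v → x * u + c + r * (x * g + v) ≡ x * (u + r * g) + r * v + c
  eq₁ = solve-∀
  eq₂ : ∀ x v g r c → x * (v + x * g) + r * v + c ≡ r * v + c + x * (x * g + v)
  eq₂ = solve-∀

monic-^ : ∀ n → Monic n (_^ n)
monic-^ zero    x = refl
monic-^ (suc n) r with g , monic-g , eq ← monic-horner n (monic-^ n) 0 r =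
  g , monic-g , λ x → trans (cong (_+ r * g x) (sym (+-identityʳ _))) (trans (eq x) (cong (_+ x * g x) (+-identityʳ _)))

-- Splitting off the largest supposed root r leaves g of degree one less. At each other root x the
-- difference r - x lies strictly between 0 and p, so p divides g(x) and the induction continues.
monic-roots : Prime p → ∀ n {f} → Monic n f → suc n < p → (∀ x → x ≤ n → p ∣ f (suc x)) → ⊥
monic-roots {p} pp zero {f} one n<p roots =
  prime≢1 pp (∣1⇒≡1 (subst (p ∣_) (one 1) (roots 0 z≤n)))
monic-roots {p} pp (suc n) {f} monic n<p roots with g , monic-g , eq ← monic (2 + n) =
  monic-roots pp n monic-g (<-trans (n<1+n _) n<p) λ x x≤n → rootsʳ x x≤n
  where
  rootsʳ : ∀ x → x ≤ n → p ∣ g (suc x)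
  rootsʳ x x≤n with i , refl ← m≤n⇒∃[o]m+o≡n x≤n =
    [ (λ p∣i → contradiction p∣i (>⇒∤ (<-≤-trans (s≤s (s≤s (m≤n+m i x))) (<⇒≤ n<p)))) , id ]′
    (euclidsLemma (suc i) (g (suc x)) pp
      (∣m+n∣m⇒∣n (subst (p ∣_) (sym eq′) (roots (suc n) ≤-refl)) (roots x (m≤n⇒m≤1+n x≤n))))
    where
    open ≡-Reasoning
    shuffle : ∀ u x i g → u + suc i * g + suc x * g ≡ u + (2 + (x + i)) * g
    shuffle = solve-∀
    eq′ : f (suc x) + suc i * g (suc x) ≡ f (2 + n)
    eq′ = +-cancelʳ-≡ (suc x * g (suc x)) _ _ (trans (shuffle (f (suc x)) x i (g (suc x))) (eq (suc x)))

-- A killing exponent e below p - 1 would give x^e + (p - 1), congruent to x^e - 1 and of degree e,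
-- the e + 1 roots 1, ..., e + 1.
kills-prime : Prime (suc r) → Kills (suc r) (suc l) → r ≤ suc l
kills-prime {r} {e} pp kill = ≮⇒≥ λ e<r → monic-roots pp (suc e) (monic-horner e (monic-^ e) r) (s<s e<r)
  (λ x x≤e → ≅0⇒∣ (≅-trans
    (≅-+ (power≅1 kill (suc x) (Cop.sym (Cop.prime⇒coprime pp (s<s (≤-<-trans x≤e e<r))))) ≅-refl)
    (∣⇒≅0 ∣-refl)))

kills-prime-∣ : Prime (suc r) → Kills (suc r) l → r ∣ l
kills-prime-∣ {zero} pp = contradiction pp ¬prime[1]
kills-prime-∣ {suc r} {e} pp kill = go (e % suc r) refl
  where
  go : ∀ i → e % suc r ≡ i → suc r ∣ e
  go zero    eq = m%n≡0⇒n∣m e (suc r) eq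
  go (suc i) eq = contradiction
    (kills-prime pp (subst (Kills (2 + r)) eq (kills-% (fermat-kills pp) kill)))
    (<⇒≱ (subst (_< suc r) eq (m%n<n e (suc r))))

-- A unit x modulo p lifts to the unit 1 + n^(p−1)·(x − 1) modulo n·p.
kills-factor : Prime p → Coprime n p → Kills (n * p) l → Kills p l
kills-factor {zero} pp = contradiction pp ¬prime[0]
kills-factor {suc zero} pp = contradiction pp ¬prime[1]
kills-factor {p@(suc (suc r))} {n} {e} pp c kill = kills go
  where
  lift≅ : ∀ x → 1 + n ^ suc r * x ≅ suc x [mod p ]
  lift≅ x = ≅-+ (≅-refl {1}) (≅-trans (≅-* (fermat′ pp c) ≅-refl) (≅-reflexive (*-identityˡ x)))
  coprime-n : ∀ x → Coprime (1 + n ^ suc r * x) n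
  coprime-n x {d} (d∣ , d∣n) = ∣1⇒≡1 (∣m+n∣m⇒∣n (subst (d ∣_) (+-comm 1 _) d∣) (∣m⇒∣m*n x (∣m⇒∣m*n (n ^ r) d∣n)))
  go : ∀ x → Coprime x p → x ^ e ≅ 1 [mod p ]
  go zero    c′ = contradiction (c′ ((_ ∣0) , ∣-refl)) (prime≢1 pp)
  go (suc x) c′ = ≅-trans (≅-^ e (≅-sym (lift≅ x))) (≅-∣-modulus (n∣m*n n) (power≅1 kill (1 + n ^ suc r * x)
    (coprime-*ʳ (coprime-n x) (coprime-≅ (≅-sym (lift≅ x)) c′))))

-- The values of d and f at n·p

gcd-*-coprime : ∀ n → Coprime x p → gcd (n * p) x ≡ gcd n x
gcd-*-coprime {x} {p} n c = ∣-antisym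
  (gcd-greatest (Cop.coprime-divisor (coprime-∣ˡ (gcd[m,n]∣n (n * p) x) c)
                  (subst (gcd (n * p) x ∣_) (*-comm n p) (gcd[m,n]∣m (n * p) x))) (gcd[m,n]∣n (n * p) x))
  (gcd-greatest (∣m⇒∣m*n p (gcd[m,n]∣m n x)) (gcd[m,n]∣n n x))

coprime-< : Prime p → .{{NonZero n}} → n < p → Coprime n p
coprime-< pp n<p = Cop.sym (prime⇒coprime pp n<p)

δ-even : 4 ∣ m → δ m ≡ 2
δ-even {m} 4∣m = choose-yes (4 ∣? m) 4∣m

δ-odd : ¬ 4 ∣ m → δ m ≡ 1
δ-odd {m} 4∤m = choose-no (4 ∣? m) 4∤m

δ∣2 : ∀ m → δ m ∣ 2
δ∣2 m with 4 ∣? m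
... | yes 4∣m = ∣-reflexive (δ-even 4∣m)
... | no  4∤m = subst (_∣ 2) (sym (δ-odd 4∤m)) (1∣ 2)

δ-*-prime : Prime p → 2 < p → ∀ n → δ (n * p) ≡ δ n
δ-*-prime {p} pp 2<p n = choose-cong (4 ∣? (n * p)) (4 ∣? n)
  (λ 4∣np → Cop.coprime-divisor (coprime-*ˡ (coprime-< pp 2<p) (coprime-< pp 2<p)) (subst (4 ∣_) (*-comm n p) 4∣np))
  (∣m⇒∣m*n p)

f-exact : ∀ m q → .{{_ : NonZero m}} → δ m * carmichael m * φ (rad m) ≡ q * φ m → f m ≡ gcd m q
f-exact m q eq = cong (gcd m) (trans (cong (_/ φ m) eq) (m*n/n≡m q (φ m)))
  where instance
    _ = φ-nonZero m

record Values (m u v : ℕ) : Set where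
  constructor values
  field
    m≢0 : NonZero m
    d≡  : d m ≡ u
    f≡  : f m {{m≢0}} ≡ v

values-cong : ∀ {m u u′ v v′} → u ≡ u′ → v ≡ v′ → Values m u v → Values m u′ v′
values-cong refl refl val = val

-- From below, an exponent for n p is one for p and hence a multiple of p - 1. From above, (p - 1)k
-- is an exponent for each of the coprime factors n and p.
carmichael-*-prime : Prime (suc r) → .{{_ : NonZero n}} → Coprime n (suc r) → Kills n (r * k) →
  ∃[ h ] h ∣ k × carmichael (n * suc r) ≡ r * h
carmichael-*-prime {zero} pp = contradiction pp ¬prime[1]
carmichael-*-prime {r@(suc _)} {n} {k} pp c kill = h , *-cancelˡ-∣ r (subst (_∣ r * k) eq λ∣rk) , eq
  where
  instance
    np≢0 : NonZero (n * suc r)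
    np≢0 = m*n≢0 n (suc r)
  r∣λ : r ∣ carmichael (n * suc r)
  r∣λ = kills-prime-∣ pp (kills-factor pp c (carmichael-kills (n * suc r)))
  h = quotient r∣λ
  eq : carmichael (n * suc r) ≡ r * h
  eq = m∣n⇒n≡m*quotient r∣λ
  λ∣rk : carmichael (n * suc r) ∣ r * k
  λ∣rk = carmichael-∣ (n * suc r) (kills-* c kill (kills-∣ (m∣m*n k) (fermat-kills pp)))

-- For b = rad n the hypothesis ny = e r b says y = e r/(n/rad n), without division.
cancel-rad : ∀ n y e r h a b c .{{_ : NonZero b}} → n * y ≡ e * r * b → c * b ≡ n * a →
  e * (r * h) * (r * a) ≡ y * h * (r * c)
cancel-rad n y e r h a b c ny≡ cb≡ = *-cancelʳ-≡ _ _ b $ begin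
  e * (r * h) * (r * a) * b   ≡⟨ eq₁ e r h a b ⟩
  e * r * b * (h * r * a)     ≡⟨ cong (_* (h * r * a)) ny≡ ⟨
  n * y * (h * r * a)         ≡⟨ eq₂ n y h r a ⟩
  y * h * r * (n * a)         ≡⟨ cong (y * h * r *_) cb≡ ⟨
  y * h * r * (c * b)         ≡⟨ eq₃ (y * h) r c b ⟩
  y * h * (r * c) * b         ∎
  where
  open ≡-Reasoning
  eq₁ : ∀ a r h b c → a * (r * h) * (r * b) * c ≡ a * r * c * (h * r * b)
  eq₁ = solve-∀
  eq₂ : ∀ n y h r b → n * y * (h * r * b) ≡ y * h * r * (n * b)
  eq₂ = solve-∀
  eq₃ : ∀ y r a b → y * r * (a * b) ≡ y * (r * a) * b
  eq₃ = solve-∀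

-- Here `y` is δ(n)(p - 1)/(n/rad n), supplied through an equation so that each construction can
-- name it in closed form, and `k` is the factor controlling `h`. The coprimality assumptions remove
-- p from both gcds, and 2 < p keeps δ unchanged.
d-f-*-prime : Prime (suc r) → 2 < suc r → .{{_ : NonZero n}} →
  Coprime n (suc r) → Coprime (φ (rad n)) (suc r) → Coprime k (suc r) →
  Kills n (r * k) → n * y ≡ δ n * r * rad n →
  ∃[ h ] h ∣ k × Values (n * suc r) (gcd n (δ n * (r * φ (rad n)))) (gcd n (y * h))
d-f-*-prime {r} {n} {k} {y} pp 2<p cn cφ ck kill ny≡ = h , h∣k , values np≢0 d≡ f≡
  where
  ρ = suc r
  exponent = carmichael-*-prime pp cn kill
  h = proj₁ exponent
  h∣k = proj₁ (proj₂ exponent)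
  λ≡ = proj₂ (proj₂ exponent)
  R = rad n
  p∤n : ¬ ρ ∣ n
  p∤n = coprime⇒∤ pp cn
  instance
    np≢0 : NonZero (n * ρ)
    np≢0 = m*n≢0 n ρ
    R≢0 : NonZero R
    R≢0 = rad≢0 n
    r≢0 : NonZero r
    r≢0 = ≢-nonZero λ { refl → ¬prime[1] pp }
  φ-rad-np : φ (rad (n * ρ)) ≡ r * φ R
  φ-rad-np = trans (cong φ (rad-*-∤ pp p∤n)) (φ-*-∤ pp (λ p∣R → p∤n (∣-trans p∣R (rad-∣ n))))
  c-r : Coprime r ρ
  c-r = coprime-< pp (n<1+n r)
  c-δ : Coprime (δ n) ρ
  c-δ = coprime-∣ˡ (δ∣2 n) (coprime-< pp 2<p)
  c-y : Coprime y ρ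
  c-y = coprime-∣ˡ (subst (y ∣_) ny≡ (n∣m*n n)) (coprime-*ˡ (coprime-*ˡ c-δ c-r) (coprime-∣ˡ (rad-∣ n) cn))
  d≡ : d (n * ρ) ≡ gcd n (δ n * (r * φ R))
  d≡ = trans (cong (gcd (n * ρ)) (cong₂ _*_ (δ-*-prime pp 2<p n) φ-rad-np))
    (gcd-*-coprime n (coprime-*ˡ c-δ (coprime-*ˡ c-r cφ)))
  numerator : δ (n * ρ) * carmichael (n * ρ) * φ (rad (n * ρ)) ≡ y * h * φ (n * ρ)
  numerator = trans
    (cong₂ _*_ (cong₂ _*_ (δ-*-prime pp 2<p n) λ≡) φ-rad-np)
    (trans (cancel-rad n y (δ n) r h (φ R) R (φ n) ny≡ (φ-rad n)) (cong (y * h *_) (sym (φ-*-∤ pp p∤n))))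
  f≡ : f (n * ρ) ≡ gcd n (y * h)
  f≡ = trans (f-exact (n * ρ) (y * h) numerator) (gcd-*-coprime n (coprime-*ˡ c-y (coprime-∣ˡ h∣k ck)))

-- Real exponents

toℚᵘ-/ : ∀ a b → toℚᵘ (ℤ.+ a ℚ./ suc b) ℚᵘ.≃ mkℚᵘ (ℤ.+ a) b
toℚᵘ-/ a b = ℚₚ.toℚᵘ-fromℚᵘ (mkℚᵘ (ℤ.+ a) b)

/<⇒ : ∀ a b c e .{{_ : NonZero b}} .{{_ : NonZero e}} → ℤ.+ a ℚ./ b ℚ.< ℤ.+ c ℚ./ e → a * e < c * b
/<⇒ a (suc b) c (suc e) lt = unwrap
  (ℚᵘₚ.<-respʳ-≃ (toℚᵘ-/ c e) (ℚᵘₚ.<-respˡ-≃ (toℚᵘ-/ a b) (ℚₚ.toℚᵘ-mono-< lt)))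
  where
  unwrap : mkℚᵘ (ℤ.+ a) b ℚᵘ.< mkℚᵘ (ℤ.+ c) e → a * suc e < c * suc b
  unwrap (*<* lt) = ℤₚ.drop‿+<+ (subst₂ ℤ._<_ (sym (ℤₚ.pos-* a (suc e))) (sym (ℤₚ.pos-* c (suc b))) lt)

linear-/ : ∀ j a b k → (ℤ.+ j ℚ./ 1) ℚ.* (ℤ.+ a ℚ./ suc b) ℚ.+ (ℤ.+ k ℚ./ 1) ≡ ℤ.+ (j * a + k * suc b) ℚ./ suc b
linear-/ j a b k = ℚₚ.toℚᵘ-injective (begin
  toℚᵘ ((ℤ.+ j ℚ./ 1) ℚ.* (ℤ.+ a ℚ./ suc b) ℚ.+ (ℤ.+ k ℚ./ 1))
    ≈⟨ ℚₚ.toℚᵘ-homo-+ ((ℤ.+ j ℚ./ 1) ℚ.* (ℤ.+ a ℚ./ suc b)) (ℤ.+ k ℚ./ 1) ⟩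
  toℚᵘ ((ℤ.+ j ℚ./ 1) ℚ.* (ℤ.+ a ℚ./ suc b)) ℚᵘ.+ toℚᵘ (ℤ.+ k ℚ./ 1)
    ≈⟨ ℚᵘₚ.+-cong (ℚᵘₚ.≃-trans (ℚₚ.toℚᵘ-homo-* (ℤ.+ j ℚ./ 1) (ℤ.+ a ℚ./ suc b))
         (ℚᵘₚ.*-cong (toℚᵘ-/ j 0) (toℚᵘ-/ a b))) (toℚᵘ-/ k 0) ⟩
  mkℚᵘ (ℤ.+ j) 0 ℚᵘ.* mkℚᵘ (ℤ.+ a) b ℚᵘ.+ mkℚᵘ (ℤ.+ k) 0
    ≈⟨ ℚᵘ.*≡* eq ⟩
  mkℚᵘ (ℤ.+ (j * a + k * suc b)) b
    ≈⟨ toℚᵘ-/ (j * a + k * suc b) b ⟨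
  toℚᵘ (ℤ.+ (j * a + k * suc b) ℚ./ suc b) ∎)
  where
  open ℚᵘₚ.≃-Reasoning
  eq : ((ℤ.+ j ℤ.* ℤ.+ a) ℤ.* ℤ.+ 1 ℤ.+ ℤ.+ k ℤ.* ℤ.+ (1 * suc b)) ℤ.* ℤ.+ suc b ≡ ℤ.+ (j * a + k * suc b) ℤ.* ℤ.+ ((1 * suc b) * 1)
  eq = cong₂ ℤ._*_
    (trans (cong₂ ℤ._+_ (trans (ℤₚ.*-identityʳ _) (sym (ℤₚ.pos-* j a)))
                        (trans (cong (λ z → ℤ.+ k ℤ.* ℤ.+ z) (*-identityˡ (suc b))) (sym (ℤₚ.pos-* k (suc b)))))
           (sym (ℤₚ.pos-+ (j * a) (k * suc b))))
    (cong ℤ.+_ (trans (sym (*-identityˡ (suc b))) (sym (*-identityʳ (1 * suc b)))))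

-- An upper bound of the j-fold sum comes with a separate bound of `L` for every summand; their
-- minimum is a single bound that serves for all.
upper-· : ∀ (L : ℝ) j {α} → Upper (j · L) α → ∃[ x ] Upper L x × (ℤ.+ j ℚ./ 1) ℚ.* x ℚ.< α
-- The empty sum provides no bound of `L`, so locatedness has to supply one.
upper-· L zero {α} 0<α with _ , x , _ , ux , _ ← located L 1ℚ (ℚₚ.positive⁻¹ 1ℚ) =
  x , ux , subst (ℚ._< α) (sym (ℚₚ.*-zeroˡ x)) 0<α
upper-· L (suc j) {α} (a , b , ua , ub , a+b<α) with x , ux , jx<b ← upper-· L j ub =
  a ℚ.⊓ x , upper-min (ℚₚ.⊓-sel a x) , ℚₚ.≤-<-trans (begin
    (ℤ.+ suc j ℚ./ 1) ℚ.* z             ≡⟨ cong (ℚ._* z) (suc-/1 j) ⟩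
    (1ℚ ℚ.+ (ℤ.+ j ℚ./ 1)) ℚ.* z        ≡⟨ ℚₚ.*-distribʳ-+ z 1ℚ (ℤ.+ j ℚ./ 1) ⟩
    1ℚ ℚ.* z ℚ.+ (ℤ.+ j ℚ./ 1) ℚ.* z    ≡⟨ cong (ℚ._+ (ℤ.+ j ℚ./ 1) ℚ.* z) (ℚₚ.*-identityˡ z) ⟩
    z ℚ.+ (ℤ.+ j ℚ./ 1) ℚ.* z           ≤⟨ ℚₚ.+-mono-≤ (ℚₚ.p⊓q≤p a x) (ℚₚ.*-monoˡ-≤-nonNeg (ℤ.+ j ℚ./ 1) {{ℚₚ.normalize-nonNeg j 1}} (ℚₚ.p⊓q≤q a x)) ⟩
    a ℚ.+ (ℤ.+ j ℚ./ 1) ℚ.* x           ≤⟨ ℚₚ.+-monoʳ-≤ a (ℚₚ.<⇒≤ jx<b) ⟩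
    a ℚ.+ b                           ∎) a+b<α
  where
  open ℚₚ.≤-Reasoning
  z = a ℚ.⊓ x
  upper-min : z ≡ a ⊎ z ≡ x → Upper L z
  upper-min (inj₁ eq) = subst (Upper L) (sym eq) ua
  upper-min (inj₂ eq) = subst (Upper L) (sym eq) ux
  suc-/1 : ∀ j → ℤ.+ suc j ℚ./ 1 ≡ 1ℚ ℚ.+ (ℤ.+ j ℚ./ 1)
  suc-/1 j = sym (trans (linear-/ 1 1 0 j) (cong (λ n → ℤ.+ n ℚ./ 1) (cong suc (*-identityʳ j))))

p<p+q : ∀ p q → 0ℚ ℚ.< q → p ℚ.< p ℚ.+ q
p<p+q p q 0<q = subst (ℚ._< p ℚ.+ q) (ℚₚ.+-identityʳ p) (ℚₚ.+-monoʳ-< p 0<q)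

^-cancelʳ-≤ : ∀ n .{{_ : NonZero n}} {a b} → a ^ n ≤ b ^ n → a ≤ b
^-cancelʳ-≤ n {a} {b} aⁿ≤bⁿ = ≮⇒≥ λ b<a → <⇒≱ (^-monoˡ-< n b<a) aⁿ≤bⁿ

^-distribʳ-* : ∀ n a b → (a * b) ^ n ≡ a ^ n * b ^ n
^-distribʳ-* zero    a b = refl
^-distribʳ-* (suc n) a b = trans (cong (a * b *_) (^-distribʳ-* n a b)) (eq a b (a ^ n) (b ^ n))
  where
  eq : ∀ a b c e → a * b * (c * e) ≡ (a * c) * (b * e)
  eq = solve-∀

^-swap : ∀ a m n → (a ^ m) ^ n ≡ (a ^ n) ^ m
^-swap a m n = trans (^-*-assoc a m n) (trans (cong (a ^_) (*-comm m n)) (sym (^-*-assoc a n m)))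

-- The summand 8 absorbs the solutions m = 1 and m = 8 that involve no prime p.
add-8 : ℝ → ℝ
add-8 c = c ⊕ fromℕ 8

add-8-positive : ∀ c → Positive c → Positive (add-8 c)
add-8-positive c 0<c = 0ℚ , 1ℚ , 0<c , ℚ.*<* (ℤ.+<+ (s≤s (s≤s z≤n))) , ℚₚ.positive⁻¹ 1ℚ

upper-add-8 : ∀ c {x} → Positive c → Upper (add-8 c) x → Upper c x × (ℤ.+ 8 ℚ./ 1) ℚ.< x
upper-add-8 c {x} 0<c (a , b , ua , 8<b , a+b<x) =
  upper-closed c (ℚₚ.<-trans (p<p+q a b (ℚₚ.<-trans (ℚₚ.positive⁻¹ (ℤ.+ 8 ℚ./ 1)) 8<b)) a+b<x) ua ,
  ℚₚ.<-trans 8<b (ℚₚ.<-trans (subst (b ℚ.<_) (ℚₚ.+-comm b a) (p<p+q b a (separated c 0<c ua))) a+b<x)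

record Bounded (L c : ℝ) (j k n m : ℕ) : Set where
  constructor bounded
  field bound : m ≤ᴿ add-8 c ∙ n ↑ (j · L ⊕ fromℕ k)

-- Every rational above `add-8 c` exceeds 8, and powers of `n` are at least 1.
small-bound : ∀ {L c j k m n} .{{_ : NonZero n}} → Positive c → m ≤ 8 → Bounded L c j k n m
small-bound {c = c} {m = m} {n} 0<c m≤8 = bounded λ u v p s uC _ → begin
  (v * m) ^ s   ≤⟨ ^-monoˡ-≤ s (vm≤u u v (proj₂ (upper-add-8 c 0<c uC))) ⟩
  u ^ s         ≤⟨ m≤m*n (u ^ s) (n ^ p) {{m^n≢0 n p}} ⟩
  u ^ s * n ^ p ∎
  where
  open ≤-Reasoning
  vm≤u : ∀ u v .{{_ : NonZero v}} → (ℤ.+ 8 ℚ./ 1) ℚ.< (ℤ.+ u ℚ./ v) → v * m ≤ u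
  vm≤u u v 8<u/v = begin
    v * m ≤⟨ *-monoʳ-≤ v m≤8 ⟩
    v * 8 ≡⟨ *-comm v 8 ⟩
    8 * v ≤⟨ <⇒≤ (/<⇒ 8 1 u v 8<u/v) ⟩
    u * 1 ≡⟨ *-identityʳ u ⟩
    u     ∎

positive-fraction : ∀ {x} → 0ℚ ℚ.< x → ∃[ a ] ∃[ b ] x ≡ ℤ.+ a ℚ./ suc b
positive-fraction {x@(mkℚ (ℤ.+ a) b _)} _ = a , b , sym (ℚₚ.↥p/↧p≡p x)
positive-fraction {mkℚ (ℤ.-[1+ a ]) b _} (ℚ.*<* ())

-- Linnik's bound is available for exponents a/t above `L`, but the goal has exponent P/s. Since P/s
-- exceeds j(a/t) + k for a suitable a/t, the inequality is proved after raising to the power t,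
-- which is then cancelled.
linnik-bound : ∀ {L c j k m n p q} .{{_ : NonZero n}} → Positive L → Positive c →
  p ≤ᴿ c ∙ q ↑ L → q ≤ n ^ j → m ≤ n ^ k * p → Bounded L c j k n m
linnik-bound {L} {c} {j} {k} {m} {n} {p} {q} 0<L 0<c p≤ q≤ m≤ = bounded go
  where
  go : m ≤ᴿ add-8 c ∙ n ↑ (j · L ⊕ fromℕ k)
  go u v P s uC (α , β , uα , k<β , α+β<P/s)
    with x , ux , jx<α ← upper-· L j uα
    with a , b , refl ← positive-fraction (separated L 0<L ux) = ^-cancelʳ-≤ t (begin
      ((v * m) ^ s) ^ t                               ≡⟨ ^-swap (v * m) s t ⟩
      ((v * m) ^ t) ^ s                               ≤⟨ ^-monoˡ-≤ s step ⟩
      (u ^ t * n ^ (j * a + k * t)) ^ s               ≡⟨ ^-distribʳ-* s (u ^ t) _ ⟩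
      (u ^ t) ^ s * (n ^ (j * a + k * t)) ^ s         ≡⟨ cong₂ _*_ (^-swap u t s) (^-*-assoc n (j * a + k * t) s) ⟩
      (u ^ s) ^ t * n ^ ((j * a + k * t) * s)         ≤⟨ *-monoʳ-≤ ((u ^ s) ^ t) (^-monoʳ-≤ n exponent) ⟩
      (u ^ s) ^ t * n ^ (P * t)                       ≡⟨ cong ((u ^ s) ^ t *_) (^-*-assoc n P t) ⟨
      (u ^ s) ^ t * (n ^ P) ^ t                       ≡⟨ ^-distribʳ-* t (u ^ s) (n ^ P) ⟨
      (u ^ s * n ^ P) ^ t                             ∎)
    where
    open ≤-Reasoning
    t = suc b
    exponent : (j * a + k * t) * s ≤ P * t
    exponent = <⇒≤ (/<⇒ (j * a + k * t) t P s (subst (ℚ._< ℤ.+ P ℚ./ s) (linear-/ j a b k)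
      (ℚₚ.<-trans (ℚₚ.+-mono-< jx<α k<β) α+β<P/s)))
    step : (v * m) ^ t ≤ u ^ t * n ^ (j * a + k * t)
    step = begin
      (v * m) ^ t                                ≤⟨ ^-monoˡ-≤ t (*-monoʳ-≤ v m≤) ⟩
      (v * (n ^ k * p)) ^ t                      ≡⟨ cong (_^ t) (shuffle v (n ^ k) p) ⟩
      (n ^ k * (v * p)) ^ t                      ≡⟨ ^-distribʳ-* t (n ^ k) (v * p) ⟩
      (n ^ k) ^ t * (v * p) ^ t                  ≤⟨ *-monoʳ-≤ ((n ^ k) ^ t) (p≤ u v a t (proj₁ (upper-add-8 c 0<c uC)) ux) ⟩
      (n ^ k) ^ t * (u ^ t * q ^ a)              ≤⟨ *-monoʳ-≤ ((n ^ k) ^ t) (*-monoʳ-≤ (u ^ t) (^-monoˡ-≤ a q≤)) ⟩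
      (n ^ k) ^ t * (u ^ t * (n ^ j) ^ a)        ≡⟨ cong₂ (λ y z → y * (u ^ t * z)) (^-*-assoc n k t) (^-*-assoc n j a) ⟩
      n ^ (k * t) * (u ^ t * n ^ (j * a))        ≡⟨ rotate (n ^ (k * t)) (u ^ t) (n ^ (j * a)) ⟩
      u ^ t * (n ^ (j * a) * n ^ (k * t))        ≡⟨ cong (u ^ t *_) (^-distribˡ-+-* n (j * a) (k * t)) ⟨
      u ^ t * n ^ (j * a + k * t)                ∎
      where
      shuffle : ∀ v z p → v * (z * p) ≡ z * (v * p)
      shuffle = solve-∀
      rotate : ∀ x y z → x * (y * z) ≡ y * (z * x)
      rotate = solve-∀

-- Splitting off and killing the parts at given primes

gcd-∣ : n ∣ x → gcd n x ≡ n
gcd-∣ {n} {x} n∣x = ∣-antisym (gcd[m,n]∣m n x) (gcd-greatest ∣-refl n∣x)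

gcd-*-cofactors : ∀ k x y → Coprime x y → gcd (k * x) (k * y) ≡ k
gcd-*-cofactors k x y c = trans (sym (c*gcd[m,n]≡gcd[cm,cn] k x y))
  (trans (cong (k *_) (Cop.coprime⇒gcd≡1 c)) (*-identityʳ k))

coprime-1+* : ∀ j n → Coprime (1 + j * n) n
coprime-1+* j n {e} (e∣ , e∣n) = ∣1⇒≡1 (∣m+n∣m⇒∣n (subst (e ∣_) (+-comm 1 (j * n)) e∣) (∣n⇒∣m*n j e∣n))

coprime-suc : n ∣ x → Coprime (suc x) n
coprime-suc {n} (divides-refl j) = coprime-1+* j n

φ[rad]≤ : ∀ n .{{_ : NonZero n}} → φ (rad n) ≤ n
φ[rad]≤ n = ≤-trans (φ≤ (rad n)) (∣⇒≤ (rad-∣ n))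

φ[rad]≢0 : ∀ n .{{_ : NonZero n}} → NonZero (φ (rad n))
φ[rad]≢0 n = φ-nonZero (rad n) {{rad≢0 n}}

-- The prime factors of x are sorted one at a time. Applied to φ(rad n), this separates the part to
-- be absorbed by N and p - 1 from the part harmless to a gcd with n.
split-coprime : ∀ n x .{{_ : NonZero x}} → ∃[ g ] ∃[ h ] x ≡ g * h × (∀ {p} → Prime p → p ∣ g → p ∣ n) × Coprime h n
split-coprime n = prime-induction _ (1 , 1 , refl , (λ pp p∣1 → contradiction (∣1⇒≡1 p∣1) (prime≢1 pp)) , Cop.1-coprimeTo n) step
  where
  step : ∀ {p m} → Prime p → .{{NonZero m}} →
    ∃[ g ] ∃[ h ] m ≡ g * h × (∀ {q} → Prime q → q ∣ g → q ∣ n) × Coprime h n →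
    ∃[ g ] ∃[ h ] m * p ≡ g * h × (∀ {q} → Prime q → q ∣ g → q ∣ n) × Coprime h n
  step {p} pp (g , h , refl , sup , c) with p ∣? n
  ... | yes p∣n = g * p , h , eq g h p ,
    (λ pq q∣gp → [ sup pq , (λ q∣p → ∣-trans q∣p p∣n) ]′ (euclidsLemma g p pq q∣gp)) , c
    where
    eq : ∀ g h p → g * h * p ≡ g * p * h
    eq = solve-∀
  ... | no  p∤n = g , h * p , *-assoc g h p , sup , coprime-*ˡ c (Cop.sym (∤⇒coprime pp p∤n))

-- For even n the number δ = 2 divides n; for odd n also n²g is odd, since g has only primes of n,
-- and δ = 1.
δ-factor : ∀ n g → (∀ {p} → Prime p → p ∣ g → p ∣ n) → ∃[ u ] n ≡ u * δ (n * (n * g))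
δ-factor n g sup with 2 ∣? n
... | yes (divides-refl u) = u , cong (u *_) (sym (δ-even (divides (u * (u * g)) (eq u g))))
  where
  eq : ∀ u g → u * 2 * (u * 2 * g) ≡ u * (u * g) * 4
  eq = solve-∀
... | no  2∤n = n , sym (trans (cong (n *_) (δ-odd 4∤)) (*-identityʳ n))
  where
  4∤ : ¬ 4 ∣ n * (n * g)
  4∤ 4∣ = 2∤n ([ id , (λ 2∣ng → [ id , sup prime[2] ]′ (euclidsLemma n g prime[2] 2∣ng)) ]′
    (euclidsLemma n (n * g) prime[2] (∣-trans (divides 2 refl) 4∣)))

odd-square : ∀ i → ∃[ z ] (1 + i * 2) ^ 2 ≡ 1 + z * 8
odd-square zero = 0 , refl
odd-square (suc i) with z , eq ← odd-square i = z + 1 + i , trans (expand i) (trans (cong (_+ (8 + i * 8)) eq) (collect i z))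
  where
  expand : ∀ i → (1 + (2 + i * 2)) * ((1 + (2 + i * 2)) * 1) ≡ (1 + i * 2) * ((1 + i * 2) * 1) + (8 + i * 8)
  expand = solve-∀
  collect : ∀ i z → 1 + z * 8 + (8 + i * 8) ≡ 1 + (z + 1 + i) * 8
  collect = solve-∀

odd : ¬ 2 ∣ k → ∃[ i ] k ≡ 1 + i * 2
odd {k} 2∤k = go (k % 2) refl (m%n<n k 2)
  where
  go : ∀ i → k % 2 ≡ i → i < 2 → ∃[ i ] k ≡ 1 + i * 2
  go 0 eq _ = contradiction (m%n≡0⇒n∣m k 2 eq) 2∤k
  go 1 eq _ = k / 2 , trans (m≡m%n+[m/n]*n k 2) (cong (_+ k / 2 * 2) eq)
  go (suc (suc _)) _ (s≤s (s≤s ()))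

-- The exponent of the units modulo a power of 2 from 8 onwards is half of φ. The start is that odd
-- squares are 1 modulo 8, and each further factor 2 costs one squaring.
kills-2^ : ∀ w → Kills (4 * 2 ^ suc w) (2 ^ suc w)
kills-2^ zero = kills λ k c → go k (λ 2∣k → contradiction (c (2∣k , divides {2} {8} 4 refl)) λ ())
  where
  go : ∀ k → ¬ 2 ∣ k → k ^ 2 ≅ 1 [mod 8 ]
  go k 2∤k with i , refl ← odd 2∤k with z , eq ← odd-square i = ≅-intro 0 z (trans (+-identityʳ _) eq)
kills-2^ (suc w) = kills λ k c → subst₂ (λ u v → u ≅ 1 [mod v ])
  (trans (^-*-assoc k (2 ^ suc w) 2) (cong (k ^_) (*-comm (2 ^ suc w) 2)))
  (sym modulus)
  (≅1-lift prime[2] (divides (2 * 2 ^ suc w) (double (2 ^ suc w)))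
    (Kills.power≅1 (kills-2^ w) k (coprime-∣ʳ (divides 2 (trans modulus (*-comm (4 * 2 ^ suc w) 2))) c)))
  where
  double : ∀ z → 4 * z ≡ 2 * z * 2
  double = solve-∀
  modulus : 4 * 2 ^ suc (suc w) ≡ 4 * 2 ^ suc w * 2
  modulus = eq (2 ^ suc w)
    where
    eq : ∀ z → 4 * (2 * z) ≡ 4 * z * 2
    eq = solve-∀

rad-2^ : ∀ w → rad (2 ^ suc w) ≡ 2
rad-2^ zero    = refl
rad-2^ (suc w) = trans (cong rad (*-comm 2 (2 ^ suc w)))
  (trans (rad-*-∣ {{m^n≢0 2 (suc w)}} prime[2] (m∣m*n (2 ^ w))) (rad-2^ w))

power-of-2 : ∀ n .{{_ : NonZero n}} → (∀ {p} → Prime p → p ∣ n → p ≡ 2) → ∃[ v ] n ≡ 2 ^ v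
power-of-2 = prime-induction _ (λ _ → 0 , refl) step
  where
  step : ∀ {p m} → Prime p → .{{NonZero m}} → ((∀ {q} → Prime q → q ∣ m → q ≡ 2) → ∃[ v ] m ≡ 2 ^ v) →
    (∀ {q} → Prime q → q ∣ m * p → q ≡ 2) → ∃[ v ] m * p ≡ 2 ^ v
  step {p} {m} pp ih only2 with v , refl ← ih (λ pq q∣m → only2 pq (∣m⇒∣m*n p q∣m))
    = suc v , trans (cong (2 ^ v *_) (only2 pp (n∣m*n m))) (*-comm (2 ^ v) 2)

coprime-2^ : ∀ v → Coprime k 2 → Coprime k (2 ^ v)
coprime-2^ zero    c = Cop.sym (Cop.1-coprimeTo _)
coprime-2^ (suc v) c = coprime-*ʳ c (coprime-2^ v c)

odd-pred-even : Prime (suc r) → suc r ≢ 2 → 2 ∣ r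
odd-pred-even {r} pp p≢2 with 2 ∣? r
... | yes 2∣r = 2∣r
... | no  2∤r with i , refl ← odd 2∤r =
  contradiction (sym (prime∣prime prime[2] pp (divides (suc i) refl))) p≢2

-- If c is even, φ(rad(c a)) and a are odd. An odd prime factor of c a would make φ(rad(c a)) even,
-- so c a is a power of 2, and its odd divisor a is 1.
even-case : ∀ a c .{{_ : NonZero (c * a)}} → Coprime c (a * φ (rad (c * a))) → 2 ∣ c → a ≡ 1 × ∃[ v ] c * a ≡ 2 ^ v
even-case a c cop 2∣c = a≡1 , is-power
  where
  coprime-2 : Coprime 2 (a * φ (rad (c * a)))
  coprime-2 = coprime-∣ˡ 2∣c cop
  only2 : ∀ {p} → Prime p → p ∣ c * a → p ≡ 2
  only2 {zero}  pp = contradiction pp ¬prime[0]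
  only2 {suc r} pp p∣b with suc r ≟ 2
  ... | yes p≡2 = p≡2
  ... | no  p≢2 = contradiction
    (coprime-2 (∣-refl , ∣n⇒∣m*n a (∣-trans (odd-pred-even pp p≢2) (prime∣⇒∣φ[rad] pp (c * a) p∣b)))) λ ()
  is-power = power-of-2 (c * a) only2
  a≡1 : a ≡ 1
  a≡1 = coprime-2^ (proj₁ is-power) (Cop.sym (coprime-∣ʳ (m∣m*n _) coprime-2))
    (∣-refl , subst (a ∣_) (proj₂ is-power) (n∣m*n c))

1+s<s*n : ∀ {s n} → 2 ≤ s → 2 ≤ n → 1 + s < s * n
1+s<s*n {s} {n} 2≤s 2≤n = begin-strict
  1 + s <⟨ +-monoˡ-< s 2≤s ⟩
  s + s ≡⟨ eq s ⟩
  s * 2 ≤⟨ *-monoʳ-≤ s 2≤n ⟩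
  s * n ∎
  where
  open ≤-Reasoning
  eq : ∀ s → s + s ≡ s * 2
  eq = solve-∀

-- The equation identifies x with φ(n), so that Euler's theorem applies to a value known only in
-- factored form.
kills-by-rad : ∀ n {e x} .{{_ : NonZero n}} → x * rad n ≡ n * φ (rad n) → x ∣ e → Kills n e
kills-by-rad n {e} {x} eq x∣e = kills-∣ (subst (_∣ e) x≡φ x∣e) (euler n)
  where
  x≡φ : x ≡ φ n
  x≡φ = *-cancelʳ-≡ x (φ n) (rad n) {{rad≢0 n}} (trans eq (sym (φ-rad n)))

1-or-≥2 : ∀ n .{{_ : NonZero n}} → n ≡ 1 ⊎ 2 ≤ n
1-or-≥2 1             = inj₁ refl
1-or-≥2 (suc (suc n)) = inj₂ (s≤s (s≤s z≤n))

values-1 : Values 1 1 1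
values-1 = values _ refl refl

values-8 : Values 8 2 1
values-8 = values _ refl refl

-- The constructions from primes in progressions

module LinnikConstruction (L c : ℝ) (0<L : Positive L) (0<c : Positive c)
  (linnik : ∀ a q → 1 ≤ a → a < q → gcd a q ≡ 1 → ∃[ p ] IsLeastPrimeInProgression a q p × p ≤ᴿ c ∙ q ↑ L) where

  linnik-prime : ∀ s q → 1 + s < q → Coprime (1 + s) q →
    ∃[ j ] Prime (1 + (s + j * q)) × 1 + (s + j * q) ≤ᴿ c ∙ q ↑ L
  linnik-prime s q s<q cop with linnik (1 + s) q (s≤s z≤n) s<q (Cop.coprime⇒gcd≡1 cop)
  ... | p , least , bound with j , refl ← IsLeastPrimeInProgression.inProgression least =
    j , IsLeastPrimeInProgression.prime least , bound

  -- w being prime to n, p − 1 = s w and s have the same n-part.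
  exact-prime : ∀ s n → 2 ≤ s → 2 ≤ n → n ∣ s →
    ∃[ w ] Prime (suc (s * w)) × Coprime w n × s ≤ s * w × suc (s * w) ≤ᴿ c ∙ s * n ↑ L
  exact-prime s n 2≤s 2≤n n∣s
    with j , pp , bound ← linnik-prime s (s * n) (1+s<s*n 2≤s 2≤n)
                            (coprime-*ʳ (coprime-suc ∣-refl) (coprime-suc n∣s)) =
    1 + j * n , subst Prime eq pp , coprime-1+* j n , m≤m*n s (1 + j * n) ,
    subst (λ p → p ≤ᴿ c ∙ s * n ↑ L) eq bound
    where
    eq : suc (s + j * (s * n)) ≡ suc (s * (1 + j * n))
    eq = cong suc (eq′ s j n)
      where
      eq′ : ∀ s j n → s + j * (s * n) ≡ s * (1 + j * n)
      eq′ = solve-∀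

  -- Of the two factors n in p - 1, one pays for the division by n/rad n and the other keeps `y` a
  -- multiple of n. Both gcds are then n.
  d≡f≡n : ∀ n .{{_ : NonZero n}} → 2 ≤ n → ∃[ p ] p ≤ᴿ c ∙ n ^ 2 ↑ L × Values (n * p) n n
  d≡f≡n n 2≤n with linnik-prime 0 (n ^ 2) 1<n² (Cop.1-coprimeTo (n ^ 2))
    where
    1<n² : 1 < n ^ 2
    1<n² = ≤-trans 2≤n (m≤m*n n (n * 1) {{m*n≢0 n 1}})
  -- The first term of the progression is 1 itself.
  ... | zero  , pp , _     = contradiction pp ¬prime[1]
  ... | suc i , pp , bound = suc r′ , bound , values-cong
      (gcd-∣ (∣n⇒∣m*n (δ n) (∣m⇒∣m*n (φ (rad n)) n∣r′)))
      (gcd-∣ (∣m⇒∣m*n (proj₁ core) (∣m⇒∣m*n (rad n) (∣n⇒∣m*n (δ n) (n∣m*n (suc i))))))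
      (proj₂ (proj₂ core))
    where
    r′ = suc i * n ^ 2
    n²≤r′ : n ^ 2 ≤ r′
    n²≤r′ = m≤n*m (n ^ 2) (suc i)
    n∣r′ : n ∣ r′
    n∣r′ = ∣n⇒∣m*n (suc i) (m∣m*n (n * 1))
    n<p : n < suc r′
    n<p = s≤s (≤-trans (m≤m*n n (n * 1) {{m*n≢0 n 1}}) n²≤r′)
    core = d-f-*-prime {k = φ n} {y = δ n * (suc i * n) * rad n} pp
      (≤-<-trans 2≤n n<p) (coprime-< pp n<p)
      (coprime-< pp {{φ[rad]≢0 n}} (≤-<-trans (φ[rad]≤ n) n<p))
      (coprime-< pp {{φ-nonZero n}} (≤-<-trans (φ≤ n) n<p))
      (kills-∣ (n∣m*n r′) (euler n))
      (eq n (δ n) (suc i) (rad n))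
      where
      eq : ∀ n e j R → n * (e * (j * n) * R) ≡ e * (j * (n * (n * 1))) * R
      eq = solve-∀

  -- With n = t R = u δ and φ(R) = g h, where R = rad n, the prime p satisfies
  -- p − 1 = n t g² u w with w prime to n; then φ(n²g) = n t g² h and the two
  -- values are n²g and n g · gcd(n, w h′) = n g for some h′ ∣ h.
  d≡n*f : ∀ n .{{_ : NonZero n}} → 2 ≤ n → ∃[ g ] ∃[ p ] ∃[ q ]
    g ≤ n × q ≤ n ^ 6 × p ≤ᴿ c ∙ q ↑ L × Values (n * (n * g) * p) (n * (n * g)) (n * g)
  d≡n*f n 2≤n
    with g , h , φR≡ , sup , h⊥n ← split-coprime n (φ (rad n)) {{φ[rad]≢0 n}}
    with u , n≡uδ ← δ-factor n g sup
    with divides t n≡tR ← rad-∣ n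
    = from-prime (exact-prime s n 2≤s 2≤n (m∣m*n (t * (g * g) * u)))
    where
    e = δ (n * (n * g))
    -- The factor n t g² is the part of φ(n²g) built from primes of n, so that only h is left to
    -- kill. The factor u completes δ to n; as t R = u δ = n, the value δ(p - 1)R/(n²g) becomes n g
    -- w.
    s = n * (t * (g * g) * u)
    n≢0 : NonZero n
    n≢0 = >-nonZero (<-trans (s≤s z≤n) 2≤n)
    instance
      gh≢0 : NonZero (g * h)
      gh≢0 = subst (λ z → NonZero z) φR≡ (φ[rad]≢0 n)
      g≢0 : NonZero g
      g≢0 = m*n≢0⇒m≢0 g
      h≢0 : NonZero h
      h≢0 = m*n≢0⇒n≢0 g
      t≢0 : NonZero t
      t≢0 = m*n≢0⇒m≢0 t {{subst (λ z → NonZero z) n≡tR n≢0}}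
      u≢0 : NonZero u
      u≢0 = m*n≢0⇒m≢0 u {{subst (λ z → NonZero z) n≡uδ n≢0}}
      gg≢0 : NonZero (g * g)
      gg≢0 = m*n≢0 g g
      tgg≢0 : NonZero (t * (g * g))
      tgg≢0 = m*n≢0 t (g * g)
      tggu≢0 : NonZero (t * (g * g) * u)
      tggu≢0 = m*n≢0 (t * (g * g)) u
      ng≢0 : NonZero (n * g)
      ng≢0 = m*n≢0 n g
      N≢0 : NonZero (n * (n * g))
      N≢0 = m*n≢0 n (n * g)
    n≤s : n ≤ s
    n≤s = m≤m*n n (t * (g * g) * u)
    2≤s : 2 ≤ s
    2≤s = ≤-trans 2≤n n≤s
    φR≤n : g * h ≤ n
    φR≤n = subst (_≤ n) φR≡ (φ[rad]≤ n)
    g≤n : g ≤ n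
    g≤n = ≤-trans (m≤m*n g h) φR≤n
    rad≡ : rad (n * (n * g)) ≡ rad n
    rad≡ = rad-supported n (n * g) (λ pp p∣ng → [ id , sup pp ]′ (euclidsLemma n g pp p∣ng))
    -- As g ≤ φ(R) ≤ R, pairing one g with t = n/R costs a single factor n.
    tg≤n : t * g ≤ n
    tg≤n = begin
      t * g       ≤⟨ *-monoʳ-≤ t (≤-trans (m≤m*n g h) (≤-trans (≤-reflexive (sym φR≡)) (φ≤ (rad n)))) ⟩
      t * rad n   ≡⟨ n≡tR ⟨
      n           ∎
      where open ≤-Reasoning
    u≤n : u ≤ n
    u≤n = ∣⇒≤ (subst (u ∣_) (sym n≡uδ) (m∣m*n e))
    sn≤n⁶ : s * n ≤ n ^ 6
    sn≤n⁶ = begin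
      n * (t * (g * g) * u) * n   ≡⟨ eq₁ n t g u ⟩
      n * ((t * g) * (g * (u * (n * 1)))) ≤⟨ *-monoʳ-≤ n (*-mono-≤ tg≤n (*-mono-≤ g≤n (*-monoˡ-≤ (n * 1) u≤n))) ⟩
      n ^ 5                       ≤⟨ ^-monoʳ-≤ n (n≤1+n 5) ⟩
      n ^ 6                       ∎
      where
      open ≤-Reasoning
      eq₁ : ∀ n t g u → n * (t * (g * g) * u) * n ≡ n * ((t * g) * (g * (u * (n * 1))))
      eq₁ = solve-∀
    from-prime : ∃[ w ] Prime (suc (s * w)) × Coprime w n × s ≤ s * w × suc (s * w) ≤ᴿ c ∙ s * n ↑ L →
      ∃[ g ] ∃[ p ] ∃[ q ]
        g ≤ n × q ≤ n ^ 6 × p ≤ᴿ c ∙ q ↑ L × Values (n * (n * g) * p) (n * (n * g)) (n * g)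
    from-prime (w , pp , w⊥n , s≤sw , bound) =
      g , suc (s * w) , s * n , g≤n , sn≤n⁶ , bound , values-cong
        (gcd-∣ N∣)
        (trans (cong₂ gcd (eq₄ n g) (eq₅ n g w (proj₁ core)))
          (gcd-*-cofactors (n * g) n (w * proj₁ core)
            (coprime-*ʳ (Cop.sym w⊥n) (Cop.sym (coprime-∣ˡ (proj₁ (proj₂ core)) h⊥n)))))
        (proj₂ (proj₂ core))
      where
      open ≡-Reasoning
      n<p : n < suc (s * w)
      n<p = s≤s (≤-trans n≤s s≤sw)
      eq₄ : ∀ n g → n * (n * g) ≡ n * g * n
      eq₄ = solve-∀
      eq₅ : ∀ n g w h → n * g * w * h ≡ n * g * (w * h)
      eq₅ = solve-∀
      n⊥p : Coprime n (suc (s * w))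
      n⊥p = coprime-< pp n<p
      φ⊥p : Coprime (g * h) (suc (s * w))
      φ⊥p = coprime-< pp (≤-<-trans φR≤n n<p)
      g⊥p : Coprime g (suc (s * w))
      g⊥p = coprime-∣ˡ (m∣m*n h) φ⊥p
      N∣ : n * (n * g) ∣ e * (s * w * φ (rad (n * (n * g))))
      N∣ = divides (t * g * w * φ (rad (n * (n * g)))) (begin
        e * (n * (t * (g * g) * u) * w * φN)   ≡⟨ eq e n t g u w φN ⟩
        t * g * w * φN * ((u * e) * (n * g)) ≡⟨ cong (λ z → t * g * w * φN * (z * (n * g))) n≡uδ ⟨
        t * g * w * φN * (n * (n * g))     ∎)
        where
        φN = φ (rad (n * (n * g)))
        eq : ∀ e n t g u w a → e * (n * (t * (g * g) * u) * w * a) ≡ t * g * w * a * ((u * e) * (n * g))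
        eq = solve-∀
      y≡ : n * (n * g) * (n * g * w) ≡ e * (s * w) * rad (n * (n * g))
      y≡ = begin
        n * (n * g) * (n * g * w)                   ≡⟨ eq₁ n g w ⟩
        n * g * g * w * (n * n)                     ≡⟨ cong₂ (λ y z → n * g * g * w * (y * z)) n≡tR n≡uδ ⟩
        n * g * g * w * (t * rad n * (u * e))       ≡⟨ eq₂ n g w t (rad n) u e ⟩
        e * (s * w) * rad n                         ≡⟨ cong (e * (s * w) *_) rad≡ ⟨
        e * (s * w) * rad (n * (n * g))             ∎
        where
        eq₁ : ∀ n g w → n * (n * g) * (n * g * w) ≡ n * g * g * w * (n * n)
        eq₁ = solve-∀
        eq₂ : ∀ n g w t R u e → n * g * g * w * (t * R * (u * e)) ≡ e * (n * (t * (g * g) * u) * w) * R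
        eq₂ = solve-∀
      φN≡ : n * t * g * g * h * rad (n * (n * g)) ≡ n * (n * g) * φ (rad (n * (n * g)))
      φN≡ = begin
        n * t * g * g * h * rad (n * (n * g))     ≡⟨ cong (n * t * g * g * h *_) rad≡ ⟩
        n * t * g * g * h * rad n                 ≡⟨ eq n t g h (rad n) ⟩
        n * (t * rad n * g) * (g * h)             ≡⟨ cong₂ (λ y z → n * (y * g) * z) (sym n≡tR) (trans (sym φR≡) (sym (cong φ rad≡))) ⟩
        n * (n * g) * φ (rad (n * (n * g)))       ∎
        where
        eq : ∀ n t g h R → n * t * g * g * h * R ≡ n * (t * R * g) * (g * h)
        eq = solve-∀
      killed : Kills (n * (n * g)) (s * w * h)
      killed = kills-by-rad (n * (n * g)) φN≡ (divides (u * w) (eq n t g u w h))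
        where
        eq : ∀ n t g u w h → n * (t * (g * g) * u) * w * h ≡ u * w * (n * t * g * g * h)
        eq = solve-∀
      core = d-f-*-prime {k = h} {y = n * g * w} pp (≤-<-trans 2≤n n<p)
        (coprime-*ˡ n⊥p (coprime-*ˡ n⊥p g⊥p))
        (subst (λ z → Coprime z (suc (s * w))) (trans (sym φR≡) (sym (cong φ rad≡))) φ⊥p)
        (coprime-∣ˡ (n∣m*n g) φ⊥p) killed y≡

  -- The prime p satisfies p − 1 = a²kw with w prime to k, so that d picks up k
  -- from b·rad k while the k-part of f cancels.
  f≡a-d≡b : ∀ a k .{{_ : NonZero a}} .{{_ : NonZero k}} → ¬ 2 ∣ k → 2 ≤ k → Coprime k (a * φ (rad (k * a))) →
    ∃[ p ] p ≤ᴿ c ∙ a * a * k * k ↑ L × Values (k * a * rad k * p) (k * a) a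
  f≡a-d≡b a k 2∤k 2≤k k⊥ with divides t a≡tA ← rad-∣ a
    = from-prime (exact-prime s k (≤-trans 2≤k k≤s) 2≤k (n∣m*n (a * a)))
    where
    -- Dividing (p - 1) rad N by N uses up k and one a; the second a is the value of f.
    s = a * a * k
    ka = k * a
    A = rad a
    R = rad k
    -- The factor R cancels the rad k contained in rad N, which would otherwise stay in `y` and
    -- enter f.
    N = ka * R
    e = δ N
    instance
      aa≢0 : NonZero (a * a)
      aa≢0 = m*n≢0 a a
      ka≢0 : NonZero ka
      ka≢0 = m*n≢0 k a
      R≢0 : NonZero R
      R≢0 = rad≢0 k
      N≢0 : NonZero N
      N≢0 = m*n≢0 ka R
    k≤s : k ≤ s
    k≤s = m≤n*m k (a * a)
    b≤s : ka ≤ s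
    b≤s = begin
      k * a       ≡⟨ *-comm k a ⟩
      a * k       ≤⟨ *-monoˡ-≤ k (m≤m*n a a) ⟩
      a * a * k   ∎
      where open ≤-Reasoning
    k⊥a : Coprime k a
    k⊥a = coprime-∣ʳ (m∣m*n (φ (rad ka))) k⊥
    k⊥φ : Coprime k (φ (rad ka))
    k⊥φ = coprime-∣ʳ (n∣m*n a) k⊥
    rad-N : rad N ≡ rad ka
    rad-N = rad-supported ka R (λ pp p∣R → ∣m⇒∣m*n a (∣-trans p∣R (rad-∣ k)))
    rad-b : rad ka ≡ R * A
    rad-b = rad-* k a k⊥a
    k⊥δ : Coprime k e
    k⊥δ = coprime-∣ʳ (δ∣2 N) (∤⇒coprime prime[2] 2∤k)
    A∣a : A ∣ a
    A∣a = rad-∣ a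
    t∣a : t ∣ a
    t∣a = subst (t ∣_) (sym a≡tA) (m∣m*n A)
    from-prime : ∃[ w ] Prime (suc (s * w)) × Coprime w k × s ≤ s * w × suc (s * w) ≤ᴿ c ∙ s * k ↑ L →
      ∃[ p ] p ≤ᴿ c ∙ s * k ↑ L × Values (N * p) ka a
    from-prime (w , pp , w⊥k , s≤sw , bound) = suc (s * w) , bound , values-cong
        (trans (cong (gcd N) (eq₁ e a k w (φ (rad N))))
          (gcd-*-cofactors ka R (e * (a * (w * φ (rad N)))) (coprime-∣ˡ (rad-∣ k)
            (coprime-*ʳ k⊥δ (coprime-*ʳ k⊥a (coprime-*ʳ (Cop.sym w⊥k) k⊥φN))))))
        (trans (cong₂ gcd (eq₂ k a R) (eq₃ a e w A (proj₁ core)))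
          (gcd-*-cofactors a (k * R) (e * w * (A * proj₁ core)) (coprime-*ˡ k⊥f (coprime-∣ˡ (rad-∣ k) k⊥f))))
        (proj₂ (proj₂ core))
      where
      open ≡-Reasoning
      eq₁ : ∀ e a k w φN → e * (a * a * k * w * φN) ≡ k * a * (e * (a * (w * φN)))
      eq₁ = solve-∀
      eq₂ : ∀ k a R → k * a * R ≡ a * (k * R)
      eq₂ = solve-∀
      eq₃ : ∀ a e w A h → e * a * w * A * h ≡ a * (e * w * (A * h))
      eq₃ = solve-∀
      k⊥φN : Coprime k (φ (rad N))
      k⊥φN = subst (λ z → Coprime k (φ z)) (sym rad-N) k⊥φ
      b<p : ka < suc (s * w)
      b<p = s≤s (≤-trans b≤s s≤sw)
      b⊥p : Coprime ka (suc (s * w))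
      b⊥p = coprime-< pp b<p
      φ⊥p : Coprime (φ (rad N)) (suc (s * w))
      φ⊥p = subst (λ z → Coprime (φ z) (suc (s * w))) (sym rad-N)
        (coprime-< pp {{φ[rad]≢0 ka}} (≤-<-trans (φ[rad]≤ ka) b<p))
      y≡ : N * (e * a * w * A) ≡ e * (s * w) * rad N
      y≡ = trans (eq k a R e w A) (cong (e * (s * w) *_) (sym (trans rad-N rad-b)))
        where
        eq : ∀ k a R e w A → k * a * R * (e * a * w * A) ≡ e * (a * a * k * w) * (R * A)
        eq = solve-∀
      φN≡ : k * t * φ (rad N) * rad N ≡ N * φ (rad N)
      φN≡ = begin
        k * t * φ (rad N) * rad N       ≡⟨ cong (k * t * φ (rad N) *_) (trans rad-N rad-b) ⟩
        k * t * φ (rad N) * (R * A)     ≡⟨ eq k t (φ (rad N)) R A ⟩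
        k * (t * A) * R * φ (rad N)     ≡⟨ cong (λ z → k * z * R * φ (rad N)) a≡tA ⟨
        N * φ (rad N)                   ∎
        where
        eq : ∀ k t φN R A → k * t * φN * (R * A) ≡ k * (t * A) * R * φN
        eq = solve-∀
      killed : Kills N (s * w * (t * φ (rad N)))
      killed = kills-by-rad N φN≡ (divides (a * a * w) (eq a k w t (φ (rad N))))
        where
        eq : ∀ a k w t φN → a * a * k * w * (t * φN) ≡ a * a * w * (k * t * φN)
        eq = solve-∀
      core = d-f-*-prime {k = t * φ (rad N)} {y = e * a * w * A} pp
        (≤-<-trans (≤-trans 2≤k (m≤m*n k a)) b<p)
        (coprime-*ˡ b⊥p (coprime-∣ˡ (∣-trans (rad-∣ k) (m∣m*n a)) b⊥p)) φ⊥p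
        (coprime-*ˡ (coprime-∣ˡ (∣-trans t∣a (n∣m*n k)) b⊥p) φ⊥p) killed y≡
      k⊥f : Coprime k (e * w * (A * proj₁ core))
      k⊥f = coprime-*ʳ (coprime-*ʳ k⊥δ (Cop.sym w⊥k)) (coprime-*ʳ (coprime-∣ʳ A∣a k⊥a)
        (coprime-∣ʳ (proj₁ (proj₂ core)) (coprime-*ʳ (coprime-∣ʳ t∣a k⊥a) k⊥φN)))

  -- Here p − 1 is exactly divisible by b/2, the other factor 2 of b being
  -- contributed to d by δ.
  f≡1-d≡2^ : ∀ v → ∃[ p ] p ≤ᴿ c ∙ 2 * 2 ^ suc v ↑ L × Values (2 * (2 * 2 ^ suc v) * p) (2 * 2 ^ suc v) 1
  f≡1-d≡2^ v = from-prime (exact-prime s 2 2≤s ≤-refl (m∣m*n (2 ^ v)))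
    where
    s = 2 ^ suc v
    N = 4 * s
    instance
      s≢0 : NonZero s
      s≢0 = m^n≢0 2 (suc v)
      N≢0 : NonZero N
      N≢0 = m*n≢0 4 s
    2≤s : 2 ≤ s
    2≤s = m≤m*n 2 (2 ^ v) {{m^n≢0 2 v}}
    N≡ : N ≡ 2 * (2 * s)
    N≡ = eq s
      where
      eq : ∀ s → 4 * s ≡ 2 * (2 * s)
      eq = solve-∀
    rad-N : rad N ≡ 2
    rad-N = trans (cong rad N≡) (rad-2^ (suc (suc v)))
    δ-N : δ N ≡ 2
    δ-N = δ-even (m∣m*n s)
    from-prime : ∃[ w ] Prime (suc (s * w)) × Coprime w 2 × s ≤ s * w × suc (s * w) ≤ᴿ c ∙ s * 2 ↑ L →
      ∃[ p ] p ≤ᴿ c ∙ 2 * s ↑ L × Values (2 * (2 * s) * p) (2 * s) 1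
    from-prime (w , pp , w⊥2 , s≤sw , bound) = suc (s * w) ,
        subst (λ q → suc (s * w) ≤ᴿ c ∙ q ↑ L) (*-comm s 2) bound ,
        subst (λ N → Values (N * suc (s * w)) (2 * s) 1) N≡ (values-cong
          (trans (cong₂ gcd (eq₁ s) (trans (cong₂ (λ y z → y * (s * w * φ z)) δ-N rad-N) (eq₂ s w)))
            (gcd-*-cofactors (2 * s) 2 w (Cop.sym w⊥2)))
          (Cop.coprime⇒gcd≡1 (coprime-*ˡ (coprime-*ˡ {2} {_} {2} 2⊥wh 2⊥wh) (Cop.sym (coprime-2^ (suc v) (Cop.sym 2⊥wh)))))
          (proj₂ (proj₂ core)))
      where
      eq₁ : ∀ s → 4 * s ≡ 2 * s * 2
      eq₁ = solve-∀
      eq₂ : ∀ s w → 2 * (s * w * 1) ≡ 2 * s * w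
      eq₂ = solve-∀
      s<p : s < suc (s * w)
      s<p = s≤s s≤sw
      2<p : 2 < suc (s * w)
      2<p = ≤-<-trans 2≤s s<p
      2⊥p : Coprime 2 (suc (s * w))
      2⊥p = coprime-< pp 2<p
      -- Euler's exponent φ(N) = 2s would require the factor 2 in place of 1, and then f could be
      -- even.
      killed : Kills N (s * w * 1)
      killed = kills-∣ (∣m⇒∣m*n 1 (m∣m*n w)) (kills-2^ v)
      y≡ : N * w ≡ δ N * (s * w) * rad N
      y≡ = trans (eq s w) (sym (cong₂ (λ y z → y * (s * w) * z) δ-N rad-N))
        where
        eq : ∀ s w → 4 * s * w ≡ 2 * (s * w) * 2
        eq = solve-∀
      core = d-f-*-prime {k = 1} {y = w} pp 2<p
        (coprime-*ˡ (coprime-*ˡ {2} {_} {2} 2⊥p 2⊥p) (coprime-< pp s<p))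
        (subst (λ z → Coprime (φ z) (suc (s * w))) (sym rad-N) (Cop.1-coprimeTo _))
        (Cop.1-coprimeTo _) killed y≡
      2⊥wh : Coprime 2 (w * proj₁ core)
      2⊥wh = coprime-*ʳ (Cop.sym w⊥2) (coprime-∣ʳ (proj₁ (proj₂ core)) (Cop.sym (Cop.1-coprimeTo 2)))

  -- Size bounds, with the small cases included

  bounded-d≡f≡n : ∀ n .{{_ : NonZero n}} → ∃[ m ] Bounded L c 2 1 n m × Values m n n
  bounded-d≡f≡n n with 1-or-≥2 n
  ... | inj₁ refl = 1 , small-bound 0<c (s≤s z≤n) , values-1
  ... | inj₂ 2≤n  = go (d≡f≡n n 2≤n)
    where
    go : ∃[ p ] p ≤ᴿ c ∙ n ^ 2 ↑ L × Values (n * p) n n → ∃[ m ] Bounded L c 2 1 n m × Values m n n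
    go (p , bound , vals) =
      n * p , linnik-bound 0<L 0<c bound ≤-refl (*-monoˡ-≤ p (≤-reflexive (sym (^-identityʳ n)))) , vals

  bounded-d≡n*f : ∀ n .{{_ : NonZero n}} → ∃[ m ] Bounded L c 6 3 n m × ∃[ u ] Values m (n * u) u
  bounded-d≡n*f n with 1-or-≥2 n
  ... | inj₁ refl = 1 , small-bound 0<c (s≤s z≤n) , 1 , values-1
  ... | inj₂ 2≤n  = go (d≡n*f n 2≤n)
    where
    go : ∃[ g ] ∃[ p ] ∃[ q ] g ≤ n × q ≤ n ^ 6 × p ≤ᴿ c ∙ q ↑ L × Values (n * (n * g) * p) (n * (n * g)) (n * g) →
      ∃[ m ] Bounded L c 6 3 n m × ∃[ u ] Values m (n * u) u
    go (g , p , q , g≤n , q≤n⁶ , bound , vals) =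
      n * (n * g) * p , linnik-bound 0<L 0<c bound q≤n⁶
        (*-monoˡ-≤ p (*-monoʳ-≤ n (*-monoʳ-≤ n (≤-trans g≤n (≤-reflexive (sym (*-identityʳ n))))))) ,
      n * g , vals

  -- For k = 1 this is the construction of (i), as a (a p) = a² p. An odd k is prime to δ, as the
  -- general construction needs, and an even k forces a power of 2.
  bounded-f≡a-d≡b : ∀ a k .{{_ : NonZero a}} .{{_ : NonZero k}} → Coprime k (a * φ (rad (k * a))) →
    ∃[ m ] Bounded L c 2 2 (k * a) (a * m) × Values m (k * a) a
  bounded-f≡a-d≡b a k k⊥ = split (1-or-≥2 k) (2 ∣? k)
    where
    Goal : ℕ → Set
    Goal b = ∃[ m ] Bounded L c 2 2 b (a * m) × Values m b a
    equal-case : a ≡ 1 ⊎ 2 ≤ a → Goal a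
    equal-case (inj₁ refl) = 1 , small-bound 0<c (s≤s z≤n) , values-1
    equal-case (inj₂ 2≤a)  = go (d≡f≡n a 2≤a)
      where
      eq : ∀ a p → a * (a * p) ≡ a * (a * 1) * p
      eq = solve-∀
      go : ∃[ p ] p ≤ᴿ c ∙ a ^ 2 ↑ L × Values (a * p) a a → Goal a
      go (p , bound , vals) = a * p , linnik-bound 0<L 0<c bound ≤-refl (≤-reflexive (eq a p)) , vals
    odd-case : ∃[ p ] p ≤ᴿ c ∙ a * a * k * k ↑ L × Values (k * a * rad k * p) (k * a) a → Goal (k * a)
    odd-case (p , bound , vals) =
      k * a * rad k * p , linnik-bound {{m*n≢0 k a}} 0<L 0<c bound (≤-reflexive (eq₁ a k)) (begin
        a * (k * a * rad k * p)   ≡⟨ eq₂ a k (rad k) p ⟩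
        k * a * (rad k * a) * p   ≤⟨ *-monoˡ-≤ p (*-monoʳ-≤ (k * a) (*-monoˡ-≤ a (∣⇒≤ (rad-∣ k)))) ⟩
        k * a * (k * a) * p       ≡⟨ eq₃ (k * a) p ⟩
        (k * a) ^ 2 * p           ∎) , vals
      where
      open ≤-Reasoning
      eq₁ : ∀ a k → a * a * k * k ≡ k * a * (k * a * 1)
      eq₁ = solve-∀
      eq₂ : ∀ a k R p → a * (k * a * R * p) ≡ k * a * (R * a) * p
      eq₂ = solve-∀
      eq₃ : ∀ b p → b * b * p ≡ b * (b * 1) * p
      eq₃ = solve-∀
    power-case : a ≡ 1 → ∀ b v → b ≡ 2 ^ v → 2 ≤ b → Goal b
    power-case _    _ 0 refl (s≤s ())
    -- For b = 2 the construction below would need p - 1 to be odd, hence p = 2, which is not prime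
    -- to N.
    power-case refl _ 1 refl _ = 8 , small-bound 0<c ≤-refl , values-8
    power-case refl b (suc (suc v)) refl 2≤b = go (f≡1-d≡2^ v)
      where
      open ≤-Reasoning
      instance
        b≢0 : NonZero b
        b≢0 = m^n≢0 2 (suc (suc v))
      go : ∃[ p ] p ≤ᴿ c ∙ b ↑ L × Values (2 * b * p) b 1 → ∃[ m ] Bounded L c 2 2 b (1 * m) × Values m b 1
      go (p , bound , vals) = 2 * b * p , linnik-bound 0<L 0<c bound (m≤m*n b (b * 1) {{m*n≢0 b 1}}) (begin
        1 * (2 * b * p)    ≡⟨ *-identityˡ (2 * b * p) ⟩
        2 * b * p          ≤⟨ *-monoˡ-≤ p (*-monoˡ-≤ b 2≤b) ⟩
        b * b * p          ≡⟨ cong (λ z → b * z * p) (*-identityʳ b) ⟨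
        b ^ 2 * p          ∎) , vals
    even : 2 ≤ k → a ≡ 1 × ∃[ v ] k * a ≡ 2 ^ v → Goal (k * a)
    even 2≤k (a≡1 , v , b≡2^v) = power-case a≡1 (k * a) v b≡2^v (≤-trans 2≤k (m≤m*n k a))
    split : k ≡ 1 ⊎ 2 ≤ k → Dec (2 ∣ k) → Goal (k * a)
    split (inj₁ k≡1) _         = subst Goal (sym (trans (cong (_* a) k≡1) (*-identityˡ a))) (equal-case (1-or-≥2 a))
    split (inj₂ 2≤k) (no 2∤k)  = odd-case (f≡a-d≡b a k 2∤k 2≤k k⊥)
    split (inj₂ 2≤k) (yes 2∣k) = even 2≤k (even-case a k {{m*n≢0 k a}} k⊥ 2∣k)

theorem1p3 : ∀ (L : ℝ) → LinnikConstant L →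
    ∃[ C ] Positive C ×
    (∀ (n : ℕ) .{{_ : NonZero n}} →
    ∃[ m ] Σ[ m≢0 ∈ NonZero m ]
    m ≤ᴿ C ∙ n ↑ (2 · L ⊕ fromℕ 1) × d m ≡ n × f m {{m≢0}} ≡ n) ×
    (∀ (n : ℕ) .{{_ : NonZero n}} →
    ∃[ m ] Σ[ m≢0 ∈ NonZero m ]
    m ≤ᴿ C ∙ n ↑ (6 · L ⊕ fromℕ 3) × d m ≡ n * f m {{m≢0}}) ×
    (∀ (a b : ℕ) .{{_ : NonZero a}} .{{_ : NonZero b}} →
    a ∣ b → gcd (b / a) (a * φ (rad b)) ≡ 1 →
    ∃[ m ] Σ[ m≢0 ∈ NonZero m ]
    a * m ≤ᴿ C ∙ b ↑ (2 · L ⊕ fromℕ 2) × f m {{m≢0}} ≡ a × d m ≡ b)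
theorem1p3 L (0<L , c , 0<c , linnik) = add-8 c , add-8-positive c 0<c ,
  (λ n → equal-values (bounded-d≡f≡n n)) ,
  (λ n → ratio-value (bounded-d≡n*f n)) ,
  part₃
  where
  open LinnikConstruction L c 0<L 0<c linnik
  equal-values : ∀ {n} → ∃[ m ] Bounded L c 2 1 n m × Values m n n → ∃[ m ] Σ[ m≢0 ∈ NonZero m ]
    m ≤ᴿ add-8 c ∙ n ↑ (2 · L ⊕ fromℕ 1) × d m ≡ n × f m {{m≢0}} ≡ n
  equal-values (m , bounded bound , values m≢0 d≡ f≡) = m , m≢0 , bound , d≡ , f≡
  ratio-value : ∀ {n} → ∃[ m ] Bounded L c 6 3 n m × (∃[ u ] Values m (n * u) u) → ∃[ m ] Σ[ m≢0 ∈ NonZero m ]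
    m ≤ᴿ add-8 c ∙ n ↑ (6 · L ⊕ fromℕ 3) × d m ≡ n * f m {{m≢0}}
  ratio-value {n} (m , bounded bound , u , values m≢0 d≡ f≡) = m , m≢0 , bound , trans d≡ (cong (n *_) (sym f≡))
  both-values : ∀ {a b} → ∃[ m ] Bounded L c 2 2 b (a * m) × Values m b a → ∃[ m ] Σ[ m≢0 ∈ NonZero m ]
    a * m ≤ᴿ add-8 c ∙ b ↑ (2 · L ⊕ fromℕ 2) × f m {{m≢0}} ≡ a × d m ≡ b
  both-values (m , bounded bound , values m≢0 d≡ f≡) = m , m≢0 , bound , f≡ , d≡
  part₃ : ∀ a b .{{_ : NonZero a}} .{{_ : NonZero b}} → a ∣ b → gcd (b / a) (a * φ (rad b)) ≡ 1 →
    ∃[ m ] Σ[ m≢0 ∈ NonZero m ] a * m ≤ᴿ add-8 c ∙ b ↑ (2 · L ⊕ fromℕ 2) × f m {{m≢0}} ≡ a × d m ≡ b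
  part₃ a _ (divides-refl k) coprime = both-values (bounded-f≡a-d≡b a k
    (Cop.gcd≡1⇒coprime (trans (cong (λ z → gcd z (a * φ (rad (k * a)))) (sym (m*n/n≡m k a))) coprime)))
    where instance
      k≢0 : NonZero k
      k≢0 = m*n≢0⇒m≢0 k
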